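{- Let $c,d\in\mathbb{Z}$ be such that $d$ is square-free and $256d-27c^4$ is not divisible by the square of any odd prime. If $4\mid(256d-27c^4)$, assume in addition that $(c\bmod 4,d\bmod 4)$ is either $(0,1)$ or $(2,3)$. Suppose $g_{c,d}(x)=x^4+cx^3+d$ is irreducible over $\mathbb{Q}$ and let $\tau$ be a root. Then $\mathbb{Q}(\tau)$ is monogenic and $\mathbb{Z}[\tau]$ is the ring of integers of $\mathbb{Q}(\tau)$.
   Context: A number field $K$ is monogenic if its ring of integers $\mathcal{O}_K$ equals $\mathbb{Z}[\alpha]$ for some $\alpha\in\mathcal{O}_K$. -}

module Defs where

open import Data.Nat as ℕ using (ℕ; zero; suc)
open import Data.Nat.Primality using (Prime)
open import Data.Integer as ℤ using (ℤ; +_)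
open import Data.Integer.Divisibility using (_∣_)
open import Data.Integer.DivMod using (_%ℕ_)
open import Data.Rational as ℚ using (ℚ; 0ℚ; 1ℚ)
open import Data.List using (List; []; _∷_)
open import Data.Product using (Σ; ∃; _×_; _,_)
open import Data.Sum using (_⊎_)
open import Relation.Nullary using (¬_)
open import Relation.Binary.PropositionalEquality using (_≡_; _≢_)
open import Function.Bundles using (_⇔_)

ι : ℤ → ℚ
ι z = z ℚ./ 1

SquareFree : ℤ → Set
SquareFree d = ∀ (p : ℕ) → Prime p → ¬ (+ (p ℕ.* p) ∣ d)

NoOddPrimeSquareDivides : ℤ → Set
NoOddPrimeSquareDivides D =
  ∀ (p : ℕ) → Prime p → p ≢ 2 → ¬ (+ (p ℕ.* p) ∣ D)

Δcd : ℤ → ℤ → ℤ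
Δcd c d = (+ 256) ℤ.* d ℤ.- (+ 27) ℤ.* (c ℤ.* c ℤ.* c ℤ.* c)

-- Polynomials over ℚ as coefficient lists (lowest degree first)

Poly : Set
Poly = List ℚ

coeff : Poly → ℕ → ℚ
coeff []       _       = 0ℚ
coeff (a ∷ p)  zero    = a
coeff (a ∷ p)  (suc n) = coeff p n

addP : Poly → Poly → Poly
addP []      q       = q
addP p       []      = p
addP (a ∷ p) (b ∷ q) = (a ℚ.+ b) ∷ addP p q

scaleP : ℚ → Poly → Poly
scaleP a []      = []
scaleP a (b ∷ q) = (a ℚ.* b) ∷ scaleP a q

mulP : Poly → Poly → Poly
mulP []      q = []
mulP (a ∷ p) q = addP (scaleP a q) (0ℚ ∷ mulP p q)

-- equality of polynomials (coefficientwise, so trailing zeros are irrelevant)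
_≈P_ : Poly → Poly → Set
p ≈P q = ∀ n → coeff p n ≡ coeff q n

NonConstant : Poly → Set
NonConstant p = ∃ λ n → coeff p (suc n) ≢ 0ℚ

-- a polynomial (of positive degree) over ℚ is irreducible over ℚ iff it is
-- not a product of two nonconstant polynomials over ℚ
IrreducibleQ : Poly → Set
IrreducibleQ g = ¬ (Σ Poly λ p → Σ Poly λ q →
                      NonConstant p × NonConstant q × (mulP p q ≈P g))

gcd-poly : ℤ → ℤ → Poly
gcd-poly c d = ι d ∷ 0ℚ ∷ 0ℚ ∷ ι c ∷ 1ℚ ∷ []

-- The field K = ℚ(τ) = ℚ[x]/(g_{c,d}), τ = class of x.
-- An element is a₀ + a₁τ + a₂τ² + a₃τ³ (unique representation).

record K : Set where
  constructor ⟨_,_,_,_⟩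
  field
    a₀ a₁ a₂ a₃ : ℚ

module _ (c d : ℤ) where

  zeroK : K
  zeroK = ⟨ 0ℚ , 0ℚ , 0ℚ , 0ℚ ⟩

  oneK : K
  oneK = ⟨ 1ℚ , 0ℚ , 0ℚ , 0ℚ ⟩

  τ : K
  τ = ⟨ 0ℚ , 1ℚ , 0ℚ , 0ℚ ⟩

  addK : K → K → K
  addK ⟨ a , b , e , f ⟩ ⟨ a' , b' , e' , f' ⟩ =
    ⟨ a ℚ.+ a' , b ℚ.+ b' , e ℚ.+ e' , f ℚ.+ f' ⟩

  scaleK : ℚ → K → K
  scaleK s ⟨ a , b , e , f ⟩ = ⟨ s ℚ.* a , s ℚ.* b , s ℚ.* e , s ℚ.* f ⟩

  -- multiplication by τ, using τ⁴ = - c τ³ - d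
  mulτ : K → K
  mulτ ⟨ a , b , e , f ⟩ =
    ⟨ ℚ.- (ι d ℚ.* f) , a , b , e ℚ.- (ι c ℚ.* f) ⟩

  mulK : K → K → K
  mulK α ⟨ b₀ , b₁ , b₂ , b₃ ⟩ =
    addK (scaleK b₀ α)
      (mulτ (addK (scaleK b₁ α)
        (mulτ (addK (scaleK b₂ α)
          (mulτ (scaleK b₃ α))))))

  evalZ : List ℤ → K → K
  evalZ []       α = zeroK
  evalZ (a ∷ as) α = addK (scaleK (ι a) oneK) (mulK α (evalZ as α))

  -- value at α of the MONIC integer polynomial a₀ + a₁x + … + a_{n-1}x^{n-1} + xⁿ
  evalMonic : List ℤ → K → K
  evalMonic []       α = oneK
  evalMonic (a ∷ as) α = addK (scaleK (ι a) oneK) (mulK α (evalMonic as α))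

  IsIntegral : K → Set
  IsIntegral α = Σ (List ℤ) λ f → evalMonic f α ≡ zeroK

  _∈ℤ[_] : K → K → Set
  α ∈ℤ[ θ ] = Σ (List ℤ) λ h → α ≡ evalZ h θ

  RingOfIntegersIs : K → Set
  RingOfIntegersIs θ = ∀ (α : K) → IsIntegral α ⇔ (α ∈ℤ[ θ ])

  Monogenic : Set
  Monogenic = Σ K λ θ → RingOfIntegersIs θ

{-# OPTIONS --safe #-}

-- Let τ be a root of g = x⁴ + c x³ + d.  An element Σ aᵢ τⁱ with integral aᵢ satisfies a monic
-- equation by eliminating the powers of τ from the four relations that express its products with
-- 1, τ, τ², τ³.  Conversely, by induction on the prime factors of a denominator it suffices that
-- an element β of ℤ[τ] with β / p integral lies in p ℤ[τ].
--
-- Such a β is nilpotent modulo p.  If p ∣ g(s) but p² ∤ g(s), and (τ - s) β ∈ p ℤ[τ], then β ∈ p ℤ[τ]: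
-- this is Dedekind's criterion at the root s.  It is used with s = 0 if p ∣ d, where g ≡ x³ (x + c), and
-- with s = 1 if p = 2 divides c but not d, where g ≡ (x - 1)⁴.
--
-- In the remaining cases one may assume β² ∈ p ℤ[τ].  The minimal polynomial k over 𝔽ₚ that annihilates
-- β then satisfies k² ∣ g, so deg k ≤ 2.  Degree 2 forces g ≡ k², which is impossible as p ∤ d and
-- not both p = 2 and p ∣ c.  If k = x - s, then s is a common root of g and g′ = x² (4x + 3c) modulo p, so
-- p ∣ y = 4s + 3c; hence p ≠ 2, and 256 g(s) = 256d - 27c⁴ + y² (y² - 8cy + 18c²) shows that p² ∤ g(s).

module Submission where

open import Defs
open import Data.Nat using (ℕ)
open import Data.Integer using (ℤ; +_)
open import Data.Integer.Divisibility using (_∣_)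
open import Data.Integer.DivMod using (_%ℕ_)
open import Data.Product using (_×_)
open import Data.Sum using (_⊎_)
open import Relation.Binary.PropositionalEquality using (_≡_)

import Algebra.Properties.CommutativeSemiring.Exp
import Algebra.Properties.Semiring.Sum
import Algebra.Solver.Ring
open import Algebra.Bundles using (CommutativeRing)
open import Algebra.Solver.Ring.AlmostCommutativeRing
  using (AlmostCommutativeRing; fromCommutativeRing; _-Raw-AlmostCommutative⟶_)
open import Data.Bool using (if_then_else_)
open import Data.Empty using (⊥-elim)
open import Data.Fin using (Fin; zero; suc; fromℕ; _≟_)
open import Data.Fin.Patterns using (0F; 1F; 2F; 3F; 4F)
open import Data.Fin.Properties using (suc-injective)
open import Data.Integer as ℤ using (0ℤ; 1ℤ)
open import Data.Integer.DivMod using (_/ℕ_; a≡a%ℕn+[a/ℕn]*n)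
open import Data.Integer.Divisibility.Signed as Signed using (divides) renaming (_∣_ to _∣ₛ_)
import Data.Integer.Properties as ℤₚ
open import Data.Integer.Solver using (module +-*-Solver)
open import Data.List as List using (List; []; _∷_; length)
open import Data.List.Properties using (length-map)
open import Data.List.Relation.Unary.All using (All; []; _∷_)
open import Data.Maybe using (Maybe; just; nothing)
open import Data.Nat as ℕ using (zero; suc)
open import Data.Nat.Coprimality using (Coprime; coprime-Bézout)
import Data.Nat.Divisibility as ℕᵈ
open import Data.Nat.GCD using (module Bézout)
open import Data.Nat.ListAction using (product)
open import Data.Nat.Primality
  using (Prime; prime[2]; ¬prime[1]; euclidsLemma; prime⇒irreducible; prime⇒nonZero)
open import Data.Nat.Primality.Factorisation using (factorise)
import Data.Nat.Properties as ℕₚ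
open import Data.Nat.Solver using () renaming (module +-*-Solver to ℕ-Solver)
open import Data.Product using (∃; _,_; proj₁; proj₂)
open import Data.Rational as ℚ using (ℚ)
import Data.Rational.Properties as ℚₚ
open import Data.Rational.Solver using () renaming (module +-*-Solver to ℚ-Solver)
open import Data.Rational.Unnormalised as ℚᵘ using (mkℚᵘ; _≃_; *≡*)
import Data.Rational.Unnormalised.Properties as ℚᵘₚ
open import Data.Sum using (inj₁; inj₂; [_,_]′)
open import Data.Vec using (Vec; []; _∷_; lookup; map; toList)
open import Data.Vec.Properties using (lookup-map)
open import Function using (id; _∘_)
open import Function.Bundles using (mk⇔)
open import Level using (0ℓ)
open import Relation.Binary.PropositionalEquality hiding (_≡_)
open import Relation.Nullary using (¬_; yes; no)
open import Relation.Nullary.Decidable using (does; dec-true; dec-false)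

open Bézout.Identity using (Identity; +-; -+)

-- The discriminant of g is d² (256d - 27c⁴), and the two conditions on squares concern its two
-- factors.
--
-- Why k² divides g: if k generates the annihilator of β in 𝔽ₚ[x], then gcd(β , g) is g / k up to a
-- unit. From β² = 0 it follows that k divides β; it also divides g, hence it divides g / k.
--
-- The polynomial k is never constructed. Instead, every polynomial of degree at most 2 that
-- annihilates β modulo p is shown either to have all its coefficients divisible by p or to force β
-- ∈ p ℤ[τ]. Dividing g and β by a monic annihilator yields annihilators of lower degree, so the
-- cubic, quadratic and linear cases reduce to a single root s.
--
-- Integrality of β / q is kept as a homogeneous equation in the pair (β , q), so that the local
-- arguments take place in ℤ[τ] and division is replaced by cancelling integers.

-- The order ℤ[τ]

-- x₀ + x₁ τ + x₂ τ² + x₃ τ³ in the order ℤ[τ].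
record Quartic : Set where
  constructor ⟪_,_,_,_⟫
  field
    x₀ x₁ x₂ x₃ : ℤ

open Quartic

⟪⟫-cong : ∀ {a a′ b b′ e e′ f f′} → a ≡ a′ → b ≡ b′ → e ≡ e′ → f ≡ f′ →
          ⟪ a , b , e , f ⟫ ≡ ⟪ a′ , b′ , e′ , f′ ⟫
⟪⟫-cong refl refl refl refl = refl

infixl 6 _⊕_
infixr 8 _⊙_
infix  8 ⊖_

-- Opaque, so that identities in the order are verified as ring identities and never coordinate by coordinate.
opaque
  _⊕_ : Quartic → Quartic → Quartic
  ⟪ a , b , e , f ⟫ ⊕ ⟪ a′ , b′ , e′ , f′ ⟫ =
    ⟪ a ℤ.+ a′ , b ℤ.+ b′ , e ℤ.+ e′ , f ℤ.+ f′ ⟫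

  ⊖_ : Quartic → Quartic
  ⊖ ⟪ a , b , e , f ⟫ = ⟪ ℤ.- a , ℤ.- b , ℤ.- e , ℤ.- f ⟫

  _⊙_ : ℤ → Quartic → Quartic
  s ⊙ ⟪ a , b , e , f ⟫ = ⟪ s ℤ.* a , s ℤ.* b , s ℤ.* e , s ℤ.* f ⟫

⌜_⌝ : ℤ → Quartic
⌜ z ⌝ = ⟪ z , 0ℤ , 0ℤ , 0ℤ ⟫

𝟘 𝟙 : Quartic
𝟘 = ⌜ 0ℤ ⌝
𝟙 = ⌜ 1ℤ ⌝

opaque
  unfolding _⊕_

  ⊕-assoc : ∀ x y z → (x ⊕ y) ⊕ z ≡ x ⊕ (y ⊕ z)
  ⊕-assoc x y z = ⟪⟫-cong (ℤₚ.+-assoc (x₀ x) _ _) (ℤₚ.+-assoc (x₁ x) _ _)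
                          (ℤₚ.+-assoc (x₂ x) _ _) (ℤₚ.+-assoc (x₃ x) _ _)

  ⊕-comm : ∀ x y → x ⊕ y ≡ y ⊕ x
  ⊕-comm x y = ⟪⟫-cong (ℤₚ.+-comm (x₀ x) _) (ℤₚ.+-comm (x₁ x) _)
                       (ℤₚ.+-comm (x₂ x) _) (ℤₚ.+-comm (x₃ x) _)

  ⊕-identityˡ : ∀ x → 𝟘 ⊕ x ≡ x
  ⊕-identityˡ x = ⟪⟫-cong (ℤₚ.+-identityˡ _) (ℤₚ.+-identityˡ _) (ℤₚ.+-identityˡ _) (ℤₚ.+-identityˡ _)

  ⊖-inverseˡ : ∀ x → ⊖ x ⊕ x ≡ 𝟘
  ⊖-inverseˡ x = ⟪⟫-cong (ℤₚ.+-inverseˡ (x₀ x)) (ℤₚ.+-inverseˡ (x₁ x))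
                         (ℤₚ.+-inverseˡ (x₂ x)) (ℤₚ.+-inverseˡ (x₃ x))

lincomb : ℤ → Quartic → ℤ → Quartic → ℤ → Quartic → ℤ → Quartic → Quartic
lincomb s x t y u z v w = s ⊙ x ⊕ (t ⊙ y ⊕ (u ⊙ z ⊕ v ⊙ w))

linear-lincomb : (F : Quartic → Quartic) → (∀ x y → F (x ⊕ y) ≡ F x ⊕ F y) → (∀ s x → F (s ⊙ x) ≡ s ⊙ F x) →
  ∀ s x t y u z v w → F (lincomb s x t y u z v w) ≡ lincomb s (F x) t (F y) u (F z) v (F w)
linear-lincomb F F-⊕ F-⊙ s x t y u z v w =
  trans (F-⊕ (s ⊙ x) _) (cong₂ _⊕_ (F-⊙ s x)
    (trans (F-⊕ (t ⊙ y) _) (cong₂ _⊕_ (F-⊙ t y)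
      (trans (F-⊕ (u ⊙ z) (v ⊙ w)) (cong₂ _⊕_ (F-⊙ u z) (F-⊙ v w))))))

module Order (c d : ℤ) where

  infixl 7 _⊛_

  open ≡-Reasoning
  open +-*-Solver using (solve; _:+_; _:*_; _:-_; :-_; con; _:=_)

  opaque
    unfolding _⊕_

    mulT : Quartic → Quartic
    mulT ⟪ a , b , e , f ⟫ = ⟪ ℤ.- (d ℤ.* f) , a , b , e ℤ.- c ℤ.* f ⟫

    mulT-⊕ : ∀ x y → mulT (x ⊕ y) ≡ mulT x ⊕ mulT y
    mulT-⊕ x y = ⟪⟫-cong
      (solve 3 (λ d a b → :- (d :* (a :+ b)) := :- (d :* a) :+ :- (d :* b)) refl d (x₃ x) (x₃ y))
      refl refl
      (solve 5 (λ c a b e f → (a :+ b) :- c :* (e :+ f) := (a :- c :* e) :+ (b :- c :* f))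
         refl c (x₂ x) (x₂ y) (x₃ x) (x₃ y))

    mulT-⊙ : ∀ s x → mulT (s ⊙ x) ≡ s ⊙ mulT x
    mulT-⊙ s x = ⟪⟫-cong
      (solve 3 (λ d s a → :- (d :* (s :* a)) := s :* :- (d :* a)) refl d s (x₃ x))
      refl refl
      (solve 4 (λ c s a b → s :* a :- c :* (s :* b) := s :* (a :- c :* b)) refl c s (x₂ x) (x₃ x))

    mulT⁴ : ∀ x → mulT (mulT (mulT (mulT x))) ≡ ⊖ (c ⊙ mulT (mulT (mulT x)) ⊕ d ⊙ x)
    mulT⁴ ⟪ a , b , e , f ⟫ = ⟪⟫-cong
      (solve 6 (λ c d a b e f →
         :- (d :* (a :- c :* (b :- c :* (e :- c :* f)))) :=
         :- (c :* :- (d :* (b :- c :* (e :- c :* f))) :+ d :* a)) refl c d a b e f)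
      (solve 6 (λ c d a b e f →
         :- (d :* (b :- c :* (e :- c :* f))) :=
         :- (c :* :- (d :* (e :- c :* f)) :+ d :* b)) refl c d a b e f)
      (solve 6 (λ c d a b e f →
         :- (d :* (e :- c :* f)) := :- (c :* :- (d :* f) :+ d :* e)) refl c d a b e f)
      (solve 6 (λ c d a b e f →
         :- (d :* f) :- c :* (a :- c :* (b :- c :* (e :- c :* f))) :=
         :- (c :* (a :- c :* (b :- c :* (e :- c :* f))) :+ d :* f)) refl c d a b e f)

    mulT-lincomb : ∀ s x t y u z v w →
      mulT (lincomb s x t y u z v w) ≡ lincomb s (mulT x) t (mulT y) u (mulT z) v (mulT w)
    mulT-lincomb = linear-lincomb mulT mulT-⊕ mulT-⊙

    -- Here y acts on x as a polynomial in the operator `mulT`. Linearity in y is then immediate,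
    -- and associativity and commutativity reduce to commuting the product with `mulT` in one
    -- argument.
    _⊛_ : Quartic → Quartic → Quartic
    x ⊛ y = lincomb (x₀ y) x (x₁ y) (mulT x) (x₂ y) (mulT (mulT x)) (x₃ y) (mulT (mulT (mulT x)))

    mulT-⊛ˡ : ∀ x y → mulT x ⊛ y ≡ mulT (x ⊛ y)
    mulT-⊛ˡ x y = sym (mulT-lincomb (x₀ y) x (x₁ y) (mulT x) (x₂ y) (mulT (mulT x)) (x₃ y) (mulT (mulT (mulT x))))

    -- The coefficient pushed past τ³ returns through `mulT⁴`; the ring laws use that relation only
    -- through this step.
    mulT-⊛ʳ : ∀ x y → x ⊛ mulT y ≡ mulT (x ⊛ y)
    mulT-⊛ʳ x y =
      let
        x′ = mulT x
        x″ = mulT x′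
        x‴ = mulT x″
        eq : (π : Quartic → ℤ) →
             (ℤ.- (d ℤ.* x₃ y)) ℤ.* π x ℤ.+ (x₀ y ℤ.* π x′ ℤ.+ (x₁ y ℤ.* π x″ ℤ.+ (x₂ y ℤ.- c ℤ.* x₃ y) ℤ.* π x‴)) ≡
             x₀ y ℤ.* π x′ ℤ.+ (x₁ y ℤ.* π x″ ℤ.+ (x₂ y ℤ.* π x‴ ℤ.+ x₃ y ℤ.* (ℤ.- (c ℤ.* π x‴ ℤ.+ d ℤ.* π x))))
        eq = λ π → solve 10 (λ c d y₀ y₁ y₂ y₃ r s t u →
           :- (d :* y₃) :* r :+ (y₀ :* s :+ (y₁ :* t :+ (y₂ :- c :* y₃) :* u)) :=
           y₀ :* s :+ (y₁ :* t :+ (y₂ :* u :+ y₃ :* :- (c :* u :+ d :* r))))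
           refl c d (x₀ y) (x₁ y) (x₂ y) (x₃ y) (π x) (π x′) (π x″) (π x‴)
      in begin
        x ⊛ mulT y
          ≡⟨⟩
        lincomb (ℤ.- (d ℤ.* x₃ y)) x (x₀ y) x′ (x₁ y) x″ (x₂ y ℤ.- c ℤ.* x₃ y) x‴
          ≡⟨ ⟪⟫-cong (eq x₀) (eq x₁) (eq x₂) (eq x₃) ⟩
        lincomb (x₀ y) x′ (x₁ y) x″ (x₂ y) x‴ (x₃ y) (⊖ (c ⊙ x‴ ⊕ d ⊙ x))
          ≡⟨ cong (lincomb (x₀ y) _ (x₁ y) _ (x₂ y) _ (x₃ y)) (sym (mulT⁴ x)) ⟩
        lincomb (x₀ y) x′ (x₁ y) x″ (x₂ y) x‴ (x₃ y) (mulT x‴)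
          ≡⟨ sym (mulT-lincomb (x₀ y) x (x₁ y) x′ (x₂ y) x″ (x₃ y) x‴) ⟩
        mulT (x ⊛ y) ∎

    ⊛-distribˡ-⊕ : ∀ x y z → x ⊛ (y ⊕ z) ≡ x ⊛ y ⊕ x ⊛ z
    ⊛-distribˡ-⊕ x y z =
      let
        eq = λ (π : Quartic → ℤ) → solve 12 (λ y₀ y₁ y₂ y₃ z₀ z₁ z₂ z₃ r s t u →
           (y₀ :+ z₀) :* r :+ ((y₁ :+ z₁) :* s :+ ((y₂ :+ z₂) :* t :+ (y₃ :+ z₃) :* u)) :=
           (y₀ :* r :+ (y₁ :* s :+ (y₂ :* t :+ y₃ :* u))) :+ (z₀ :* r :+ (z₁ :* s :+ (z₂ :* t :+ z₃ :* u))))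
           refl (x₀ y) (x₁ y) (x₂ y) (x₃ y) (x₀ z) (x₁ z) (x₂ z) (x₃ z)
           (π x) (π (mulT x)) (π (mulT (mulT x))) (π (mulT (mulT (mulT x))))
      in ⟪⟫-cong (eq x₀) (eq x₁) (eq x₂) (eq x₃)

    ⊛-⊙ʳ : ∀ s x y → x ⊛ (s ⊙ y) ≡ s ⊙ (x ⊛ y)
    ⊛-⊙ʳ s x y =
      let
        eq = λ (π : Quartic → ℤ) → solve 9 (λ a y₀ y₁ y₂ y₃ r s t u →
           (a :* y₀) :* r :+ ((a :* y₁) :* s :+ ((a :* y₂) :* t :+ (a :* y₃) :* u)) :=
           a :* (y₀ :* r :+ (y₁ :* s :+ (y₂ :* t :+ y₃ :* u))))
           refl s (x₀ y) (x₁ y) (x₂ y) (x₃ y)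
           (π x) (π (mulT x)) (π (mulT (mulT x))) (π (mulT (mulT (mulT x))))
      in ⟪⟫-cong (eq x₀) (eq x₁) (eq x₂) (eq x₃)

    ⊛-lincomb : ∀ X s x t y u z v w → X ⊛ lincomb s x t y u z v w ≡ lincomb s (X ⊛ x) t (X ⊛ y) u (X ⊛ z) v (X ⊛ w)
    ⊛-lincomb X = linear-lincomb (X ⊛_) (⊛-distribˡ-⊕ X) (λ s x → ⊛-⊙ʳ s X x)

    ⊛-assoc : ∀ x y z → (x ⊛ y) ⊛ z ≡ x ⊛ (y ⊛ z)
    ⊛-assoc x y z =
      let
        y′ = mulT y
        y″ = mulT y′
      in begin
        lincomb (x₀ z) (x ⊛ y) (x₁ z) (mulT (x ⊛ y)) (x₂ z) (mulT (mulT (x ⊛ y))) (x₃ z) (mulT (mulT (mulT (x ⊛ y))))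
          ≡⟨ cong (λ w → lincomb (x₀ z) (x ⊛ y) (x₁ z) w (x₂ z) (mulT w) (x₃ z) (mulT (mulT w))) (sym (mulT-⊛ʳ x y)) ⟩
        lincomb (x₀ z) (x ⊛ y) (x₁ z) (x ⊛ y′) (x₂ z) (mulT (x ⊛ y′)) (x₃ z) (mulT (mulT (x ⊛ y′)))
          ≡⟨ cong (λ w → lincomb (x₀ z) (x ⊛ y) (x₁ z) (x ⊛ y′) (x₂ z) w (x₃ z) (mulT w)) (sym (mulT-⊛ʳ x y′)) ⟩
        lincomb (x₀ z) (x ⊛ y) (x₁ z) (x ⊛ y′) (x₂ z) (x ⊛ y″) (x₃ z) (mulT (x ⊛ y″))
          ≡⟨ cong (lincomb (x₀ z) (x ⊛ y) (x₁ z) (x ⊛ y′) (x₂ z) (x ⊛ y″) (x₃ z)) (sym (mulT-⊛ʳ x y″)) ⟩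
        lincomb (x₀ z) (x ⊛ y) (x₁ z) (x ⊛ y′) (x₂ z) (x ⊛ y″) (x₃ z) (x ⊛ mulT y″)
          ≡⟨ sym (⊛-lincomb x (x₀ z) y (x₁ z) y′ (x₂ z) y″ (x₃ z) (mulT y″)) ⟩
        x ⊛ (y ⊛ z) ∎

    ⊛-identityʳ : ∀ x → x ⊛ 𝟙 ≡ x
    ⊛-identityʳ x =
      let
        eq = λ (π : Quartic → ℤ) →
          solve 4 (λ r s t u → con 1ℤ :* r :+ (con 0ℤ :* s :+ (con 0ℤ :* t :+ con 0ℤ :* u)) := r)
           refl (π x) (π (mulT x)) (π (mulT (mulT x))) (π (mulT (mulT (mulT x))))
      in ⟪⟫-cong (eq x₀) (eq x₁) (eq x₂) (eq x₃)

    ⊛-identityˡ : ∀ x → 𝟙 ⊛ x ≡ x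
    ⊛-identityˡ x =
      ⟪⟫-cong
        (solve 6 (λ c d a b e f →
           a :* con 1ℤ :+ (b :* (:- (d :* con 0ℤ)) :+ (e :* :- (d :* (con 0ℤ :- c :* con 0ℤ)) :+
               f :* :- (d :* (con 0ℤ :- c :* (con 0ℤ :- c :* con 0ℤ))))) := a) refl c d (x₀ x) (x₁ x) (x₂ x) (x₃ x))
        (solve 6 (λ c d a b e f →
           a :* con 0ℤ :+ (b :* con 1ℤ :+ (e :* (:- (d :* con 0ℤ)) :+ f :* :- (d :* (con 0ℤ :- c :* con 0ℤ)))) :=
               b) refl c d (x₀ x) (x₁ x) (x₂ x) (x₃ x))
        (solve 6 (λ c d a b e f →
           a :* con 0ℤ :+ (b :* con 0ℤ :+ (e :* con 1ℤ :+ f :* (:- (d :* con 0ℤ)))) := e)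
               refl c d (x₀ x) (x₁ x) (x₂ x) (x₃ x))
        (solve 6 (λ c d a b e f →
           a :* con 0ℤ :+ (b :* (con 0ℤ :- c :* con 0ℤ) :+ (e :* (con 0ℤ :- c :* (con 0ℤ :- c :* con 0ℤ)) :+
               f :* (con 1ℤ :- c :* (con 0ℤ :- c :* (con 0ℤ :- c :* con 0ℤ))))) := f)
               refl c d (x₀ x) (x₁ x) (x₂ x) (x₃ x))

    ⊛-distribʳ-⊕ : ∀ x y z → (y ⊕ z) ⊛ x ≡ y ⊛ x ⊕ z ⊛ x
    ⊛-distribʳ-⊕ x y z =
      let
        y′ = mulT y
        y″ = mulT y′
        y‴ = mulT y″
        z′ = mulT z
        z″ = mulT z′
        z‴ = mulT z″
        eq = λ (π : Quartic → ℤ) (y z y′ z′ y″ z″ y‴ z‴ : Quartic) → solve 12 (λ x₀ x₁ x₂ x₃ y₀ y₁ y₂ y₃ z₀ z₁ z₂ z₃ →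
           x₀ :* (y₀ :+ z₀) :+ (x₁ :* (y₁ :+ z₁) :+ (x₂ :* (y₂ :+ z₂) :+ x₃ :* (y₃ :+ z₃))) :=
           (x₀ :* y₀ :+ (x₁ :* y₁ :+ (x₂ :* y₂ :+ x₃ :* y₃))) :+ (x₀ :* z₀ :+ (x₁ :* z₁ :+ (x₂ :* z₂ :+ x₃ :* z₃))))
           refl (x₀ x) (x₁ x) (x₂ x) (x₃ x) (π y) (π y′) (π y″) (π y‴) (π z) (π z′) (π z″) (π z‴)
      in begin
        (y ⊕ z) ⊛ x
          ≡⟨ cong (λ w → lincomb (x₀ x) (y ⊕ z) (x₁ x) w (x₂ x) (mulT w) (x₃ x) (mulT (mulT w))) (mulT-⊕ y z) ⟩
        lincomb (x₀ x) (y ⊕ z) (x₁ x) (y′ ⊕ z′) (x₂ x) (mulT (y′ ⊕ z′)) (x₃ x) (mulT (mulT (y′ ⊕ z′)))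
          ≡⟨ cong (λ w → lincomb (x₀ x) (y ⊕ z) (x₁ x) (y′ ⊕ z′) (x₂ x) w (x₃ x) (mulT w)) (mulT-⊕ y′ z′) ⟩
        lincomb (x₀ x) (y ⊕ z) (x₁ x) (y′ ⊕ z′) (x₂ x) (y″ ⊕ z″) (x₃ x) (mulT (y″ ⊕ z″))
          ≡⟨ cong (lincomb (x₀ x) (y ⊕ z) (x₁ x) (y′ ⊕ z′) (x₂ x) (y″ ⊕ z″) (x₃ x)) (mulT-⊕ y″ z″) ⟩
        lincomb (x₀ x) (y ⊕ z) (x₁ x) (y′ ⊕ z′) (x₂ x) (y″ ⊕ z″) (x₃ x) (y‴ ⊕ z‴)
          ≡⟨ ⟪⟫-cong (eq x₀ y z y′ z′ y″ z″ y‴ z‴) (eq x₁ y z y′ z′ y″ z″ y‴ z‴)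
                     (eq x₂ y z y′ z′ y″ z″ y‴ z‴) (eq x₃ y z y′ z′ y″ z″ y‴ z‴) ⟩
        y ⊛ x ⊕ z ⊛ x ∎

    ⊛-⊙ˡ : ∀ s x y → (s ⊙ x) ⊛ y ≡ s ⊙ (x ⊛ y)
    ⊛-⊙ˡ s x y =
      let
        x′ = mulT x
        x″ = mulT x′
        x‴ = mulT x″
        eq = λ (π : Quartic → ℤ) (x x′ x″ x‴ : Quartic) → solve 9 (λ s y₀ y₁ y₂ y₃ r t u v →
           y₀ :* (s :* r) :+ (y₁ :* (s :* t) :+ (y₂ :* (s :* u) :+ y₃ :* (s :* v))) :=
           s :* (y₀ :* r :+ (y₁ :* t :+ (y₂ :* u :+ y₃ :* v))))
           refl s (x₀ y) (x₁ y) (x₂ y) (x₃ y) (π x) (π x′) (π x″) (π x‴)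
      in begin
        (s ⊙ x) ⊛ y
          ≡⟨ cong (λ w → lincomb (x₀ y) (s ⊙ x) (x₁ y) w (x₂ y) (mulT w) (x₃ y) (mulT (mulT w))) (mulT-⊙ s x) ⟩
        lincomb (x₀ y) (s ⊙ x) (x₁ y) (s ⊙ x′) (x₂ y) (mulT (s ⊙ x′)) (x₃ y) (mulT (mulT (s ⊙ x′)))
          ≡⟨ cong (λ w → lincomb (x₀ y) (s ⊙ x) (x₁ y) (s ⊙ x′) (x₂ y) w (x₃ y) (mulT w)) (mulT-⊙ s x′) ⟩
        lincomb (x₀ y) (s ⊙ x) (x₁ y) (s ⊙ x′) (x₂ y) (s ⊙ x″) (x₃ y) (mulT (s ⊙ x″))
          ≡⟨ cong (lincomb (x₀ y) (s ⊙ x) (x₁ y) (s ⊙ x′) (x₂ y) (s ⊙ x″) (x₃ y)) (mulT-⊙ s x″) ⟩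
        lincomb (x₀ y) (s ⊙ x) (x₁ y) (s ⊙ x′) (x₂ y) (s ⊙ x″) (x₃ y) (s ⊙ x‴)
          ≡⟨ ⟪⟫-cong (eq x₀ x x′ x″ x‴) (eq x₁ x x′ x″ x‴) (eq x₂ x x′ x″ x‴) (eq x₃ x x′ x″ x‴) ⟩
        s ⊙ (x ⊛ y) ∎

    ⊛-comm : ∀ x y → x ⊛ y ≡ y ⊛ x
    ⊛-comm x y =
      let
        t = mulT 𝟙
        t² = mulT t
        t³ = mulT t²
      in begin
        x ⊛ y
          ≡⟨ cong (_⊛ y) (sym (⊛-identityˡ x)) ⟩
        lincomb (x₀ x) 𝟙 (x₁ x) t (x₂ x) t² (x₃ x) t³ ⊛ y
          ≡⟨ linear-lincomb (_⊛ y) (λ z w → ⊛-distribʳ-⊕ y z w) (λ s z → ⊛-⊙ˡ s z y)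
               (x₀ x) 𝟙 (x₁ x) t (x₂ x) t² (x₃ x) t³ ⟩
        lincomb (x₀ x) (𝟙 ⊛ y) (x₁ x) (t ⊛ y) (x₂ x) (t² ⊛ y) (x₃ x) (t³ ⊛ y)
          ≡⟨ cong₂ (λ z w → lincomb (x₀ x) (𝟙 ⊛ y) (x₁ x) (t ⊛ y) (x₂ x) z (x₃ x) w)
               (mulT-⊛ˡ t y) (trans (mulT-⊛ˡ t² y) (cong mulT (mulT-⊛ˡ t y))) ⟩
        lincomb (x₀ x) (𝟙 ⊛ y) (x₁ x) (t ⊛ y) (x₂ x) (mulT (t ⊛ y)) (x₃ x) (mulT (mulT (t ⊛ y)))
          ≡⟨ cong (λ w → lincomb (x₀ x) (𝟙 ⊛ y) (x₁ x) w (x₂ x) (mulT w) (x₃ x) (mulT (mulT w))) (mulT-⊛ˡ 𝟙 y) ⟩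
        (𝟙 ⊛ y) ⊛ x
          ≡⟨ cong (_⊛ x) (⊛-identityˡ y) ⟩
        y ⊛ x ∎

  commutativeRing : CommutativeRing 0ℓ 0ℓ
  commutativeRing = record
    { Carrier = Quartic ; _≈_ = _≡_ ; _+_ = _⊕_ ; _*_ = _⊛_ ; -_ = ⊖_ ; 0# = 𝟘 ; 1# = 𝟙
    ; isCommutativeRing = record
      { isRing = record
        { +-isAbelianGroup = record
          { isGroup = record
            { isMonoid = record
              { isSemigroup = record
                { isMagma = record { isEquivalence = isEquivalence ; ∙-cong = cong₂ _⊕_ }
                ; assoc = ⊕-assoc }
              ; identity = ⊕-identityˡ , (λ x → trans (⊕-comm x 𝟘) (⊕-identityˡ x)) }
            ; inverse = ⊖-inverseˡ , (λ x → trans (⊕-comm x (⊖ x)) (⊖-inverseˡ x))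
            ; ⁻¹-cong = cong ⊖_ }
          ; comm = ⊕-comm }
        ; *-cong = cong₂ _⊛_
        ; *-assoc = ⊛-assoc
        ; *-identity = ⊛-identityˡ , ⊛-identityʳ
        ; distrib = ⊛-distribˡ-⊕ , ⊛-distribʳ-⊕ }
      ; *-comm = ⊛-comm } }

  open CommutativeRing commutativeRing public
    using (semiring; commutativeSemiring; zeroʳ; *-identityʳ)
  open Algebra.Properties.CommutativeSemiring.Exp commutativeSemiring public
    using (_^_; ^-distrib-*; ^-homo-*)

  opaque
    unfolding mulT

    ⌜⌝-⊛ : ∀ z x → ⌜ z ⌝ ⊛ x ≡ z ⊙ x
    ⌜⌝-⊛ z x =
      let
        eq = λ (π : Quartic → ℤ) →
          solve 5 (λ z r s t u → z :* r :+ (con 0ℤ :* s :+ (con 0ℤ :* t :+ con 0ℤ :* u)) := z :* r)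
           refl z (π x) (π (mulT x)) (π (mulT (mulT x))) (π (mulT (mulT (mulT x))))
      in begin
        ⌜ z ⌝ ⊛ x     ≡⟨ ⊛-comm ⌜ z ⌝ x ⟩
        x ⊛ ⌜ z ⌝     ≡⟨ ⟪⟫-cong (eq x₀) (eq x₁) (eq x₂) (eq x₃) ⟩
        z ⊙ x         ∎

    ⌜⌝-+ : ∀ y z → ⌜ y ℤ.+ z ⌝ ≡ ⌜ y ⌝ ⊕ ⌜ z ⌝
    ⌜⌝-+ _ _ = refl

    ⌜⌝-* : ∀ y z → ⌜ y ℤ.* z ⌝ ≡ ⌜ y ⌝ ⊛ ⌜ z ⌝
    ⌜⌝-* y z = sym (trans (⌜⌝-⊛ y ⌜ z ⌝) (⟪⟫-cong refl (ℤₚ.*-zeroʳ y) (ℤₚ.*-zeroʳ y) (ℤₚ.*-zeroʳ y)))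

    ⌜⌝-neg : ∀ y → ⌜ ℤ.- y ⌝ ≡ ⊖ ⌜ y ⌝
    ⌜⌝-neg _ = refl

  ⌜⌝-homomorphism : AlmostCommutativeRing.rawRing (fromCommutativeRing ℤₚ.+-*-commutativeRing)
                    -Raw-AlmostCommutative⟶ fromCommutativeRing commutativeRing
  ⌜⌝-homomorphism = record
    { ⟦_⟧ = ⌜_⌝ ; +-homo = ⌜⌝-+ ; *-homo = ⌜⌝-* ; -‿homo = ⌜⌝-neg ; 0-homo = refl ; 1-homo = refl }

  ⌜⌝-≟ : (y z : ℤ) → Maybe (⌜ y ⌝ ≡ ⌜ z ⌝)
  ⌜⌝-≟ y z with y ℤₚ.≟ z
  ... | yes y≡z = just (cong ⌜_⌝ y≡z)
  ... | no _    = nothing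

  module Q = Algebra.Solver.Ring _ _ ⌜⌝-homomorphism ⌜⌝-≟

-- Integral quotients

euclid : ∀ {p} → Prime p → ∀ x y → + p ∣ₛ x ℤ.* y → + p ∣ₛ x ⊎ + p ∣ₛ y
euclid {p} pr x y p∣xy with euclidsLemma ℤ.∣ x ∣ ℤ.∣ y ∣ pr (subst (p ℕᵈ.∣_) (ℤₚ.abs-* x y) (Signed.∣⇒∣ᵤ p∣xy))
... | inj₁ h = inj₁ (Signed.∣ᵤ⇒∣ h)
... | inj₂ h = inj₂ (Signed.∣ᵤ⇒∣ h)

module Integrality (c d : ℤ) where

  open Order c d
  open ≡-Reasoning

  t : Quartic
  t = ⟪ 0ℤ , 1ℤ , 0ℤ , 0ℤ ⟫

  -- The value at (β , q) of the homogenised monic polynomial with lower coefficients as.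
  hom : List Quartic → Quartic → Quartic → Quartic
  hom []       β q = 𝟙
  hom (a ∷ as) β q = a ⊛ q ^ suc (length as) ⊕ β ⊛ hom as β q

  hom-scale : ∀ z as β q → hom as (z ⊛ β) (z ⊛ q) ≡ z ^ length as ⊛ hom as β q
  hom-scale z []       β q = sym (⊛-identityˡ 𝟙)
  hom-scale z (a ∷ as) β q = begin
    a ⊛ (z ⊛ q) ^ suc (length as) ⊕ z ⊛ β ⊛ hom as (z ⊛ β) (z ⊛ q)
      ≡⟨ cong₂ (λ u v → a ⊛ u ⊕ z ⊛ β ⊛ v) (^-distrib-* z q (suc (length as))) (hom-scale z as β q) ⟩
    a ⊛ (z ⊛ zⁿ ⊛ (q ⊛ qⁿ)) ⊕ z ⊛ β ⊛ (zⁿ ⊛ hom as β q)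
      ≡⟨ Q.solve 7 (λ a z zⁿ q qⁿ β h →
           a Q.:* (z Q.:* zⁿ Q.:* (q Q.:* qⁿ)) Q.:+ z Q.:* β Q.:* (zⁿ Q.:* h) Q.:=
           z Q.:* zⁿ Q.:* (a Q.:* (q Q.:* qⁿ) Q.:+ β Q.:* h)) refl a z zⁿ q qⁿ β (hom as β q) ⟩
    z ⊛ zⁿ ⊛ (a ⊛ (q ⊛ qⁿ) ⊕ β ⊛ hom as β q) ∎
    where
    zⁿ = z ^ length as
    qⁿ = q ^ length as

  -- The coefficient at distance k from the leading one is multiplied by zᵏ, as in the equation
  -- satisfied by z times a root.
  twist : Quartic → List Quartic → List Quartic
  twist z []       = []
  twist z (a ∷ as) = a ⊛ z ^ suc (length as) ∷ twist z as

  length-twist : ∀ z as → length (twist z as) ≡ length as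
  length-twist z []       = refl
  length-twist z (a ∷ as) = cong suc (length-twist z as)

  hom-twist : ∀ z as β q → hom (twist z as) β q ≡ hom as β (z ⊛ q)
  hom-twist z []       β q = refl
  hom-twist z (a ∷ as) β q = cong₂ (λ u v → u ⊕ β ⊛ v)
    (begin
      a ⊛ z ^ suc (length as) ⊛ q ^ suc (length (twist z as))
        ≡⟨ cong (λ n → a ⊛ z ^ suc (length as) ⊛ q ^ suc n) (length-twist z as) ⟩
      a ⊛ z ^ suc (length as) ⊛ q ^ suc (length as)
        ≡⟨ ⊛-assoc a _ _ ⟩
      a ⊛ (z ^ suc (length as) ⊛ q ^ suc (length as))
        ≡⟨ cong (a ⊛_) (sym (^-distrib-* z q (suc (length as)))) ⟩
      a ⊛ (z ⊛ q) ^ suc (length as) ∎)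
    (hom-twist z as β q)

  hom-power : ∀ as β q → ∃ λ y → hom as β q ≡ β ^ length as ⊕ q ⊛ y
  hom-power []       β q = 𝟘 , Q.solve 1 (λ q → Q.con 1ℤ Q.:= Q.con 1ℤ Q.:+ q Q.:* Q.con 0ℤ) refl q
  hom-power (a ∷ as) β q with hom-power as β q
  ... | y , eq = a ⊛ q ^ length as ⊕ β ⊛ y , trans (cong (λ h → a ⊛ (q ⊛ q ^ length as) ⊕ β ⊛ h) eq)
    (Q.solve 6 (λ a q qⁿ β βⁿ y →
      a Q.:* (q Q.:* qⁿ) Q.:+ β Q.:* (βⁿ Q.:+ q Q.:* y) Q.:= β Q.:* βⁿ Q.:+ q Q.:* (a Q.:* qⁿ Q.:+ β Q.:* y))
      refl a q (q ^ length as) β (β ^ length as) y)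

  -- β / q is integral over ℤ[τ].
  Integral : Quartic → Quartic → Set
  Integral β q = ∃ λ as → hom as β q ≡ 𝟘

  -- The coefficients of an equation may lie in ℤ[τ], so z merely rescales them. With integer
  -- coefficients this would require that integral elements form a ring.
  integral-⊛ : ∀ z β q → Integral β q → Integral (z ⊛ β) q
  integral-⊛ z β q (as , eq) = twist z as , (begin
    hom (twist z as) (z ⊛ β) q  ≡⟨ hom-twist z as (z ⊛ β) q ⟩
    hom as (z ⊛ β) (z ⊛ q)      ≡⟨ hom-scale z as β q ⟩
    z ^ length as ⊛ hom as β q  ≡⟨ cong (z ^ length as ⊛_) eq ⟩
    z ^ length as ⊛ 𝟘           ≡⟨ zeroʳ _ ⟩
    𝟘                           ∎)

  -- β / q is z times β / (z q).
  integral-factor : ∀ z β q → Integral β (z ⊛ q) → Integral β q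
  integral-factor z β q (as , eq) = twist z as , trans (hom-twist z as β q) eq

  integral-power : ∀ β q → Integral β q → ∃ λ n → ∃ λ y → β ^ n ≡ q ⊛ y
  integral-power β q (as , eq) with hom-power as β q
  ... | y , eq′ = length as , ⊖ y , (begin
    β ^ length as
      ≡⟨ Q.solve 3 (λ b q y → b Q.:= b Q.:+ q Q.:* y Q.:+ q Q.:* Q.:- y) refl (β ^ length as) q y ⟩
    β ^ length as ⊕ q ⊛ y ⊕ q ⊛ ⊖ y
      ≡⟨ cong (_⊕ q ⊛ ⊖ y) (trans (sym eq′) eq) ⟩
    𝟘 ⊕ q ⊛ ⊖ y
      ≡⟨ ⊕-identityˡ _ ⟩
    q ⊛ ⊖ y ∎)

∣-comb : ∀ {k x y} z u v → k ∣ₛ x → k ∣ₛ y → z ≡ u ℤ.* x ℤ.+ v ℤ.* y → k ∣ₛ z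
∣-comb z u v k∣x k∣y refl = Signed.∣m∣n⇒∣m+n (Signed.∣n⇒∣m*n u k∣x) (Signed.∣n⇒∣m*n v k∣y)

-- Evaluation at an integer, and the basis of powers of τ

module Roots (c d : ℤ) where

  open Order c d
  open Integrality c d
  open ≡-Reasoning
  open +-*-Solver using (solve; _:+_; _:*_; _:-_; :-_; con; _:=_)

  g : ℤ → ℤ
  g s = s ℤ.* s ℤ.* s ℤ.* s ℤ.+ c ℤ.* (s ℤ.* s ℤ.* s) ℤ.+ d

  ev : ℤ → Quartic → ℤ
  ev s x = x₀ x ℤ.+ s ℤ.* x₁ x ℤ.+ s ℤ.* s ℤ.* x₂ x ℤ.+ s ℤ.* s ℤ.* s ℤ.* x₃ x

  root : ℤ → Quartic
  root s = t ⊕ ⌜ ℤ.- s ⌝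

  opaque
    unfolding _⊕_ mulT

    ⌜⌝-⊛-coordinates : ∀ m x → ⌜ m ⌝ ⊛ x ≡ ⟪ m ℤ.* x₀ x , m ℤ.* x₁ x , m ℤ.* x₂ x , m ℤ.* x₃ x ⟫
    ⌜⌝-⊛-coordinates = ⌜⌝-⊛

    t⊛ : ∀ x → t ⊛ x ≡ ⟪ ℤ.- (d ℤ.* x₃ x) , x₀ x , x₁ x , x₂ x ℤ.- c ℤ.* x₃ x ⟫
    t⊛ x = begin
      t ⊛ x              ≡⟨ cong (_⊛ x) (⟪⟫-cong (sym (cong ℤ.-_ (ℤₚ.*-zeroʳ d))) refl
          refl (sym (cong (λ z → 0ℤ ℤ.- z) (ℤₚ.*-zeroʳ c)))) ⟩
      mulT 𝟙 ⊛ x         ≡⟨ mulT-⊛ˡ 𝟙 x ⟩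
      mulT (𝟙 ⊛ x)       ≡⟨ cong mulT (⊛-identityˡ x) ⟩
      mulT x             ∎

    root-⊛ : ∀ s x → root s ⊛ x ≡ ⟪ ℤ.- (d ℤ.* x₃ x) ℤ.- s ℤ.* x₀ x , x₀ x ℤ.- s ℤ.* x₁ x , x₁ x ℤ.- s ℤ.* x₂ x ,
        x₂ x ℤ.- c ℤ.* x₃ x ℤ.- s ℤ.* x₃ x ⟫
    root-⊛ s x = begin
      root s ⊛ x              ≡⟨ ⊛-distribʳ-⊕ x t ⌜ ℤ.- s ⌝ ⟩
      t ⊛ x ⊕ ⌜ ℤ.- s ⌝ ⊛ x   ≡⟨ cong₂ _⊕_ (t⊛ x) (⌜⌝-⊛ (ℤ.- s) x) ⟩
      ⟪ ℤ.- (d ℤ.* x₃ x) , x₀ x , x₁ x , x₂ x ℤ.- c ℤ.* x₃ x ⟫ ⊕ (ℤ.- s) ⊙ x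
        ≡⟨ ⟪⟫-cong (neg (x₀ x) (ℤ.- (d ℤ.* x₃ x))) (neg (x₁ x) (x₀ x)) (neg (x₂ x) (x₁ x)) (neg (x₃ x) (x₂ x ℤ.- c ℤ.* x₃ x)) ⟩
      ⟪ ℤ.- (d ℤ.* x₃ x) ℤ.- s ℤ.* x₀ x , x₀ x ℤ.- s ℤ.* x₁ x , x₁ x ℤ.- s ℤ.* x₂ x ,
          x₂ x ℤ.- c ℤ.* x₃ x ℤ.- s ℤ.* x₃ x ⟫ ∎
      where
      neg : ∀ y z → z ℤ.+ (ℤ.- s) ℤ.* y ≡ z ℤ.- s ℤ.* y
      neg y z = cong (λ w → z ℤ.+ w) (sym (ℤₚ.neg-distribˡ-* s y))

    ⊕-coordinates : ∀ x y → x ⊕ y ≡ ⟪ x₀ x ℤ.+ x₀ y , x₁ x ℤ.+ x₁ y , x₂ x ℤ.+ x₂ y , x₃ x ℤ.+ x₃ y ⟫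
    ⊕-coordinates _ _ = refl

    ev-mulT : ∀ s x → ev s (mulT x) ≡ s ℤ.* ev s x ℤ.- x₃ x ℤ.* g s
    ev-mulT s x = solve 7 (λ c d s a b e f →
      (:- (d :* f)) :+ s :* a :+ s :* s :* b :+ s :* s :* s :* (e :- c :* f) :=
      s :* (a :+ s :* b :+ s :* s :* e :+ s :* s :* s :* f) :- f :* (s :* s :* s :* s :+ c :* (s :* s :* s) :+ d))
      refl c d s (x₀ x) (x₁ x) (x₂ x) (x₃ x)

    ev-⊕ : ∀ s x y → ev s (x ⊕ y) ≡ ev s x ℤ.+ ev s y
    ev-⊕ s x y = solve 9 (λ s a b e f a′ b′ e′ f′ →
      (a :+ a′) :+ s :* (b :+ b′) :+ s :* s :* (e :+ e′) :+ s :* s :* s :* (f :+ f′) :=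
      (a :+ s :* b :+ s :* s :* e :+ s :* s :* s :* f) :+ (a′ :+ s :* b′ :+ s :* s :* e′ :+ s :* s :* s :* f′))
      refl s (x₀ x) (x₁ x) (x₂ x) (x₃ x) (x₀ y) (x₁ y) (x₂ y) (x₃ y)

    ev-⊙ : ∀ s m x → ev s (m ⊙ x) ≡ m ℤ.* ev s x
    ev-⊙ s m x = solve 6 (λ s m a b e f →
      m :* a :+ s :* (m :* b) :+ s :* s :* (m :* e) :+ s :* s :* s :* (m :* f) :=
      m :* (a :+ s :* b :+ s :* s :* e :+ s :* s :* s :* f)) refl s m (x₀ x) (x₁ x) (x₂ x) (x₃ x)

    ev-lincomb : ∀ s a x b y e z f w →
      ev s (lincomb a x b y e z f w) ≡ a ℤ.* ev s x ℤ.+ (b ℤ.* ev s y ℤ.+ (e ℤ.* ev s z ℤ.+ f ℤ.* ev s w))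
    ev-lincomb s a x b y e z f w =
      trans (ev-⊕ s (a ⊙ x) _) (cong₂ ℤ._+_ (ev-⊙ s a x)
        (trans (ev-⊕ s (b ⊙ y) _) (cong₂ ℤ._+_ (ev-⊙ s b y)
          (trans (ev-⊕ s (e ⊙ z) (f ⊙ w)) (cong₂ ℤ._+_ (ev-⊙ s e z) (ev-⊙ s f w))))))

    -- Substituting s for τ respects products only up to multiples of g(s). The witness collects the
    -- overflow terms of `ev-mulT`.
    ev-⊛ : ∀ s x y → ∃ λ z → ev s (x ⊛ y) ≡ ev s x ℤ.* ev s y ℤ.+ g s ℤ.* z
    ev-⊛ s x y = _ , (begin
      ev s (x ⊛ y)
        ≡⟨ ev-lincomb s (x₀ y) x (x₁ y) x′ (x₂ y) (mulT x′) (x₃ y) (mulT (mulT x′)) ⟩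
      x₀ y ℤ.* ev s x ℤ.+ (x₁ y ℤ.* ev s x′ ℤ.+ (x₂ y ℤ.* ev s (mulT x′) ℤ.+ x₃ y ℤ.* ev s (mulT (mulT x′))))
        ≡⟨ cong (λ w → x₀ y ℤ.* ev s x ℤ.+ (x₁ y ℤ.* ev s x′ ℤ.+ (x₂ y ℤ.* ev s (mulT x′) ℤ.+
            x₃ y ℤ.* w))) (ev-mulT s (mulT x′)) ⟩
      x₀ y ℤ.* ev s x ℤ.+ (x₁ y ℤ.* ev s x′ ℤ.+ (x₂ y ℤ.* ev s (mulT x′) ℤ.+
          x₃ y ℤ.* (s ℤ.* ev s (mulT x′) ℤ.- x₃ (mulT x′) ℤ.* g s)))
        ≡⟨ cong (λ w → x₀ y ℤ.* ev s x ℤ.+ (x₁ y ℤ.* ev s x′ ℤ.+ (x₂ y ℤ.* w ℤ.+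
            x₃ y ℤ.* (s ℤ.* w ℤ.- x₃ (mulT x′) ℤ.* g s)))) (ev-mulT s x′) ⟩
      _ ≡⟨ cong (λ w → x₀ y ℤ.* ev s x ℤ.+ (x₁ y ℤ.* w ℤ.+ (x₂ y ℤ.* (s ℤ.* w ℤ.- x₃ x′ ℤ.* g s) ℤ.+
          x₃ y ℤ.* (s ℤ.* (s ℤ.* w ℤ.- x₃ x′ ℤ.* g s) ℤ.- x₃ (mulT x′) ℤ.* g s)))) (ev-mulT s x) ⟩
      _ ≡⟨ solve 10 (λ s E G k l m y₀ y₁ y₂ y₃ →
             y₀ :* E :+ (y₁ :* (s :* E :- k :* G) :+ (y₂ :* (s :* (s :* E :- k :* G) :- l :* G) :+
                 y₃ :* (s :* (s :* (s :* E :- k :* G) :- l :* G) :- m :* G))) :=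
             E :* (y₀ :+ s :* y₁ :+ s :* s :* y₂ :+ s :* s :* s :* y₃) :+ G :* :- (y₁ :* k :+ y₂ :* (s :* k :+
                 l) :+ y₃ :* (s :* (s :* k :+ l) :+ m)))
             refl s (ev s x) (g s) (x₃ x) (x₃ x′) (x₃ (mulT x′)) (x₀ y) (x₁ y) (x₂ y) (x₃ y) ⟩
      ev s x ℤ.* ev s y ℤ.+ g s ℤ.* _ ∎)
      where
      x′ : Quartic
      x′ = mulT x

  ev-⌜⌝⊛ : ∀ s m x → ev s (⌜ m ⌝ ⊛ x) ≡ m ℤ.* ev s x
  ev-⌜⌝⊛ s m x = trans (cong (ev s) (⌜⌝-⊛ m x)) (ev-⊙ s m x)

  -- The unreduced product with x - s vanishes at s, and its reduction subtracts `x₃ x` times g.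
  ev-root-⊛ : ∀ s x → ev s (root s ⊛ x) ≡ ℤ.- (x₃ x ℤ.* g s)
  ev-root-⊛ s x = trans (cong (ev s) (root-⊛ s x))
    (solve 7 (λ c d s a b e f →
      (:- (d :* f) :- s :* a) :+ s :* (a :- s :* b) :+ s :* s :* (b :- s :* e) :+
          s :* s :* s :* (e :- c :* f :- s :* f) :=
      :- (f :* (s :* s :* s :* s :+ c :* (s :* s :* s) :+ d)))
      refl c d s (x₀ x) (x₁ x) (x₂ x) (x₃ x))

  ⌜⌝-cancel : ∀ m .{{_ : ℤ.NonZero m}} {x} → ⌜ m ⌝ ⊛ x ≡ 𝟘 → x ≡ 𝟘
  ⌜⌝-cancel m {x} h = ⟪⟫-cong (cancel (cong x₀ eq)) (cancel (cong x₁ eq)) (cancel (cong x₂ eq)) (cancel (cong x₃ eq))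
    where
    eq = trans (sym (⌜⌝-⊛-coordinates m x)) h
    cancel : ∀ {y} → m ℤ.* y ≡ 0ℤ → y ≡ 0ℤ
    cancel {y} my≡0 = ℤₚ.*-cancelˡ-≡ m y 0ℤ (trans my≡0 (sym (ℤₚ.*-zeroʳ m)))

  -- A second reading of solver expressions, this time in ℤ. With `expand` it rewrites the image of
  -- a whole integer expression at once, instead of applying `⌜⌝-+` and `⌜⌝-*` node by node.
  evalℤ : ∀ {n} → Q.Polynomial n → Vec ℤ n → ℤ
  evalℤ (Q.op Q.[+] e f) ρ = evalℤ e ρ ℤ.+ evalℤ f ρ
  evalℤ (Q.op Q.[*] e f) ρ = evalℤ e ρ ℤ.* evalℤ f ρ
  evalℤ (Q.con z)        ρ = z
  evalℤ (Q.var i)        ρ = lookup ρ i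
  evalℤ (e Q.:^ n)       ρ = evalℤ e ρ ℤ.^ n
  evalℤ (Q.:- e)         ρ = ℤ.- evalℤ e ρ

  expand : ∀ {n} (e : Q.Polynomial n) ρ → ⌜ evalℤ e ρ ⌝ ≡ Q.⟦ e ⟧ (map ⌜_⌝ ρ)
  expand (Q.op Q.[+] e f) ρ = trans (⌜⌝-+ (evalℤ e ρ) (evalℤ f ρ)) (cong₂ _⊕_ (expand e ρ) (expand f ρ))
  expand (Q.op Q.[*] e f) ρ = trans (⌜⌝-* (evalℤ e ρ) (evalℤ f ρ)) (cong₂ _⊛_ (expand e ρ) (expand f ρ))
  expand (Q.con z)        ρ = refl
  expand (Q.var i)        ρ = sym (lookup-map i ⌜_⌝ ρ)
  expand (e Q.:^ n)       ρ = trans (⌜⌝-^ (evalℤ e ρ) n) (cong (_^ n) (expand e ρ))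
    where
    ⌜⌝-^ : ∀ z n → ⌜ z ℤ.^ n ⌝ ≡ ⌜ z ⌝ ^ n
    ⌜⌝-^ z zero    = refl
    ⌜⌝-^ z (suc n) = trans (⌜⌝-* z (z ℤ.^ n)) (cong (⌜ z ⌝ ⊛_) (⌜⌝-^ z n))
  expand (Q.:- e)         ρ = trans (⌜⌝-neg (evalℤ e ρ)) (cong ⊖_ (expand e ρ))

  opaque
    unfolding _⊕_ mulT

    mulT-t : ∀ x → mulT x ≡ t ⊛ x
    mulT-t x = sym (t⊛ x)

    ⊛-lincomb-powers : ∀ x y → x ⊛ y ≡ lincomb (x₀ y) x (x₁ y) (mulT x) (x₂ y) (mulT (mulT x)) (x₃ y) (mulT (mulT (mulT x)))
    ⊛-lincomb-powers x y = refl

  mulT-𝟙 : mulT 𝟙 ≡ t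
  mulT-𝟙 = trans (mulT-t 𝟙) (⊛-identityʳ t)

  mulT²-𝟙 : mulT (mulT 𝟙) ≡ t ⊛ t
  mulT²-𝟙 = trans (mulT-t _) (cong (t ⊛_) mulT-𝟙)

  mulT³-𝟙 : mulT (mulT (mulT 𝟙)) ≡ t ⊛ (t ⊛ t)
  mulT³-𝟙 = trans (mulT-t _) (cong (t ⊛_) mulT²-𝟙)

  basis : ∀ x → x ≡ ⌜ x₀ x ⌝ ⊕ ⌜ x₁ x ⌝ ⊛ t ⊕ ⌜ x₂ x ⌝ ⊛ (t ⊛ t) ⊕ ⌜ x₃ x ⌝ ⊛ (t ⊛ (t ⊛ t))
  basis x = begin
    x        ≡⟨ ⊛-identityˡ x ⟨
    𝟙 ⊛ x    ≡⟨ ⊛-lincomb-powers 𝟙 x ⟩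
    x₀ x ⊙ 𝟙 ⊕ (x₁ x ⊙ mulT 𝟙 ⊕ (x₂ x ⊙ mulT (mulT 𝟙) ⊕ x₃ x ⊙ mulT (mulT (mulT 𝟙))))
      ≡⟨ cong₂ _⊕_ (trans (sym (⌜⌝-⊛ (x₀ x) 𝟙)) (⊛-identityʳ _))
           (cong₂ _⊕_ (power (x₁ x) mulT-𝟙) (cong₂ _⊕_ (power (x₂ x) mulT²-𝟙) (power (x₃ x) mulT³-𝟙))) ⟩
    ⌜ x₀ x ⌝ ⊕ (⌜ x₁ x ⌝ ⊛ t ⊕ (⌜ x₂ x ⌝ ⊛ (t ⊛ t) ⊕ ⌜ x₃ x ⌝ ⊛ (t ⊛ (t ⊛ t))))
      ≡⟨ Q.solve 4 (λ a b e f → a Q.:+ (b Q.:+ (e Q.:+ f)) Q.:= a Q.:+ b Q.:+ e Q.:+ f)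
          refl ⌜ x₀ x ⌝ (⌜ x₁ x ⌝ ⊛ t) (⌜ x₂ x ⌝ ⊛ (t ⊛ t)) (⌜ x₃ x ⌝ ⊛ (t ⊛ (t ⊛ t))) ⟩
    _ ∎
    where
    power : ∀ z {y y′} → y ≡ y′ → z ⊙ y ≡ ⌜ z ⌝ ⊛ y′
    power z refl = sym (⌜⌝-⊛ z _)

  minimal : t ⊛ (t ⊛ (t ⊛ t)) ⊕ ⌜ c ⌝ ⊛ (t ⊛ (t ⊛ t)) ⊕ ⌜ d ⌝ ≡ 𝟘
  minimal = begin
    t ⊛ (t ⊛ (t ⊛ t)) ⊕ ⌜ c ⌝ ⊛ (t ⊛ (t ⊛ t)) ⊕ ⌜ d ⌝
      ≡⟨ cong (λ z → z ⊕ ⌜ c ⌝ ⊛ (t ⊛ (t ⊛ t)) ⊕ ⌜ d ⌝) t⁴ ⟩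
    ⊖ (⌜ c ⌝ ⊛ (t ⊛ (t ⊛ t)) ⊕ ⌜ d ⌝) ⊕ ⌜ c ⌝ ⊛ (t ⊛ (t ⊛ t)) ⊕ ⌜ d ⌝
      ≡⟨ Q.solve 2 (λ x d → Q.:- (x Q.:+ d) Q.:+ x Q.:+ d Q.:= Q.con 0ℤ) refl (⌜ c ⌝ ⊛ (t ⊛ (t ⊛ t))) ⌜ d ⌝ ⟩
    𝟘 ∎
    where
    t⁴ : t ⊛ (t ⊛ (t ⊛ t)) ≡ ⊖ (⌜ c ⌝ ⊛ (t ⊛ (t ⊛ t)) ⊕ ⌜ d ⌝)
    t⁴ = begin
      t ⊛ (t ⊛ (t ⊛ t))                          ≡⟨ cong (t ⊛_) mulT³-𝟙 ⟨
      t ⊛ mulT (mulT (mulT 𝟙))                   ≡⟨ mulT-t _ ⟨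
      mulT (mulT (mulT (mulT 𝟙)))                ≡⟨ mulT⁴ 𝟙 ⟩
      ⊖ (c ⊙ mulT (mulT (mulT 𝟙)) ⊕ d ⊙ 𝟙)
        ≡⟨ cong ⊖_ (cong₂ _⊕_ (trans (cong (c ⊙_) mulT³-𝟙) (sym (⌜⌝-⊛ c _))) (trans
            (sym (⌜⌝-⊛ d 𝟙)) (⊛-identityʳ _))) ⟩
      ⊖ (⌜ c ⌝ ⊛ (t ⊛ (t ⊛ t)) ⊕ ⌜ d ⌝)          ∎

  -- `Q.solve` treats `t` as an indeterminate. Identities that hold only in ℤ[τ] are therefore first
  -- proved with an explicit multiple of g(t), which this lemma or `minimal-⊛` then removes.
  minimal-⊕ : ∀ x → t ⊛ (t ⊛ (t ⊛ t)) ⊕ ⌜ c ⌝ ⊛ (t ⊛ (t ⊛ t)) ⊕ ⌜ d ⌝ ⊕ x ≡ x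
  minimal-⊕ x = trans (cong (_⊕ x) minimal) (⊕-identityˡ x)

  minimal-⊛ : ∀ m z → (t ⊛ (t ⊛ (t ⊛ t)) ⊕ ⌜ c ⌝ ⊛ (t ⊛ (t ⊛ t)) ⊕ ⌜ d ⌝) ⊛ m ⊕ z ≡ z
  minimal-⊛ m z = trans (cong (λ x → x ⊛ m ⊕ z) minimal)
    (Q.solve 2 (λ m z → Q.con 0ℤ Q.:* m Q.:+ z Q.:= z) refl m z)

-- Reduction modulo a prime

module Local (c d : ℤ) {p : ℕ} (pr : Prime p) where

  open Order c d
  open Integrality c d
  open Roots c d
  open ≡-Reasoning
  open +-*-Solver using (solve; _:+_; _:*_; _:-_; :-_; con; _:=_)

  π : Quartic
  π = ⌜ + p ⌝

  pO : Quartic → Set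
  pO x = ∃ λ y → x ≡ π ⊛ y

  pO-⊕ : ∀ {x y} → pO x → pO y → pO (x ⊕ y)
  pO-⊕ (x′ , refl) (y′ , refl) = x′ ⊕ y′ , sym (⊛-distribˡ-⊕ π x′ y′)

  pO-⊛ : ∀ z {x} → pO x → pO (z ⊛ x)
  pO-⊛ z (x′ , refl) = z ⊛ x′ , Q.solve 3 (λ z π x → z Q.:* (π Q.:* x) Q.:= π Q.:* (z Q.:* x)) refl z π x′

  pO-π : ∀ x → pO (π ⊛ x)
  pO-π x = x , refl

  pO-comb : ∀ {x y} z u v → pO x → pO y → z ≡ u ⊛ x ⊕ v ⊛ y → pO z
  pO-comb z u v Px Py refl = pO-⊕ (pO-⊛ u Px) (pO-⊛ v Py)

  pO-coordinates : ∀ {a b e f} → pO ⟪ a , b , e , f ⟫ → + p ∣ₛ a × + p ∣ₛ b × + p ∣ₛ e × + p ∣ₛ f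
  pO-coordinates (y , eq) with trans eq (⌜⌝-⊛-coordinates (+ p) y)
  ... | refl = divides (x₀ y) (ℤₚ.*-comm (+ p) _) , divides (x₁ y) (ℤₚ.*-comm (+ p) _) ,
               divides (x₂ y) (ℤₚ.*-comm (+ p) _) , divides (x₃ y) (ℤₚ.*-comm (+ p) _)

  coordinates⇒pO : ∀ {a b e f} → + p ∣ₛ a → + p ∣ₛ b → + p ∣ₛ e → + p ∣ₛ f → pO ⟪ a , b , e , f ⟫
  coordinates⇒pO (divides a refl) (divides b refl) (divides e refl) (divides f refl) = ⟪ a , b , e , f ⟫ ,
    sym (trans (⌜⌝-⊛-coordinates (+ p) _) (⟪⟫-cong (ℤₚ.*-comm (+ p) a) (ℤₚ.*-comm (+ p) b) (ℤₚ.*-comm (+ p) e) (ℤₚ.*-comm (+ p) f)))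

  ⌜⌝-inverse : ∀ w u y → w ℤ.* u ≡ 1ℤ ℤ.+ y ℤ.* + p → ⌜ w ⌝ ⊛ ⌜ u ⌝ ≡ 𝟙 ⊕ ⌜ y ⌝ ⊛ π
  ⌜⌝-inverse w u y eq = begin
    ⌜ w ⌝ ⊛ ⌜ u ⌝              ≡⟨ ⌜⌝-* w u ⟨
    ⌜ w ℤ.* u ⌝                ≡⟨ cong ⌜_⌝ eq ⟩
    ⌜ 1ℤ ℤ.+ y ℤ.* + p ⌝       ≡⟨ ⌜⌝-+ 1ℤ _ ⟩
    𝟙 ⊕ ⌜ y ℤ.* + p ⌝          ≡⟨ cong (𝟙 ⊕_) (⌜⌝-* y (+ p)) ⟩
    𝟙 ⊕ ⌜ y ⌝ ⊛ π              ∎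

  pO-const : ∀ {m} → + p ∣ₛ m → pO ⌜ m ⌝
  pO-const p∣m = coordinates⇒pO p∣m p∣0 p∣0 p∣0
    where
    p∣0 : + p ∣ₛ 0ℤ
    p∣0 = divides 0ℤ refl

  pO-linear : ∀ {u v} → + p ∣ₛ u → + p ∣ₛ v → pO (⌜ u ⌝ ⊛ t ⊕ ⌜ v ⌝)
  pO-linear {u} {v} p∣u p∣v = pO-comb _ t 𝟙 (pO-const p∣u) (pO-const p∣v)
    (cong₂ _⊕_ (⊛-comm ⌜ u ⌝ t) (sym (⊛-identityˡ ⌜ v ⌝)))

  unit : ∀ {m x} → pO (⌜ m ⌝ ⊛ x) → + p ∣ₛ m ⊎ pO x
  unit {m} {x} Pmx with + p Signed.∣? m
  ... | yes p∣m = inj₁ p∣m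
  ... | no  p∤m with pO-coordinates (subst pO (⌜⌝-⊛-coordinates m x) Pmx)
  ... | a , b , e , f = inj₂ (coordinates⇒pO (cancel (x₀ x) a) (cancel (x₁ x) b) (cancel (x₂ x) e) (cancel (x₃ x) f))
    where
    cancel : ∀ y → + p ∣ₛ m ℤ.* y → + p ∣ₛ y
    cancel y h = [ ⊥-elim ∘ p∤m , id ]′ (euclid pr m y h)

  -- A root s of g modulo p gives a ring homomorphism from ℤ[τ] to the field 𝔽ₚ.
  ev-⊛-cancel : ∀ s x y → + p ∣ₛ g s → + p ∣ₛ ev s (x ⊛ y) → + p ∣ₛ ev s x ⊎ + p ∣ₛ ev s y
  ev-⊛-cancel s x y p∣g p∣ev with ev-⊛ s x y
  ... | z , eq = euclid pr (ev s x) (ev s y) (∣-comb _ 1ℤ (ℤ.- z) p∣ev p∣g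
    (trans (solve 3 (λ e g z → e := con 1ℤ :* (e :+ g :* z) :+ (:- z) :* g) refl (ev s x ℤ.* ev s y) (g s) z)
           (cong (λ w → 1ℤ ℤ.* w ℤ.+ (ℤ.- z) ℤ.* g s) (sym eq))))

  ev-pO : ∀ s {x} → pO x → + p ∣ₛ ev s x
  ev-pO s (y , refl) = divides (ev s y) (trans (ev-⌜⌝⊛ s (+ p) y) (ℤₚ.*-comm (+ p) _))

  p∤1 : ¬ (+ p ∣ₛ 1ℤ)
  p∤1 h = ¬prime[1] (subst Prime (ℕᵈ.∣1⇒≡1 (Signed.∣⇒∣ᵤ h)) pr)

  ev-power-cancel : ∀ s n x → + p ∣ₛ g s → + p ∣ₛ ev s (x ^ n) → + p ∣ₛ ev s x
  ev-power-cancel s zero    x p∣g p∣ev = ⊥-elim (p∤1 (subst (λ w → + p ∣ₛ w)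
    (solve 1 (λ s → con 1ℤ :+ s :* con 0ℤ :+ s :* s :* con 0ℤ :+ s :* s :* s :* con 0ℤ := con 1ℤ) refl s) p∣ev))
  ev-power-cancel s (suc n) x p∣g p∣ev =
    [ id , ev-power-cancel s n x p∣g ]′ (ev-⊛-cancel s x (x ^ n) p∣g p∣ev)

  -- Modulo p the annihilator of τ - s is generated by (g(x) - g(s)) / (x - s).
  annihilated-by-root : ∀ s {x} → pO (root s ⊛ x) →
    + p ∣ₛ x₂ x ℤ.- (c ℤ.+ s) ℤ.* x₃ x × + p ∣ₛ x₁ x ℤ.- s ℤ.* x₂ x × + p ∣ₛ x₀ x ℤ.- s ℤ.* x₁ x
  annihilated-by-root s {x} h with pO-coordinates (subst pO (root-⊛ s x) h)
  ... | _ , h₁ , h₂ , h₃ = subst (λ w → + p ∣ₛ w)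
    (solve 4 (λ c s e f → e :- c :* f :- s :* f := e :- (c :+ s) :* f) refl c s (x₂ x) (x₃ x)) h₃ , h₂ , h₁

  annihilated-by-root⇒pO : ∀ s {x} → pO (root s ⊛ x) → + p ∣ₛ x₃ x → pO x
  annihilated-by-root⇒pO s {x} h p∣f = coordinates⇒pO p∣x₀ p∣x₁ p∣x₂ p∣f
    where
    h₂ = proj₁ (annihilated-by-root s h)
    h₁ = proj₁ (proj₂ (annihilated-by-root s h))
    h₀ = proj₂ (proj₂ (annihilated-by-root s h))
    back : ∀ {y z} k → + p ∣ₛ y ℤ.- k ℤ.* z → + p ∣ₛ z → + p ∣ₛ y
    back {y} {z} k p∣y-kz p∣z = ∣-comb y 1ℤ k p∣y-kz p∣z
      (solve 3 (λ y k z → y := con 1ℤ :* (y :- k :* z) :+ k :* z) refl y k z)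
    p∣x₂ : + p ∣ₛ x₂ x
    p∣x₂ = back (c ℤ.+ s) h₂ p∣f
    p∣x₁ : + p ∣ₛ x₁ x
    p∣x₁ = back s h₁ p∣x₂
    p∣x₀ : + p ∣ₛ x₀ x
    p∣x₀ = back s h₀ p∣x₁

  -- (τ - s) h = - g(s) for h = (g(x) - g(s)) / (x - s).
  nonroot : ∀ s {x} → pO (root s ⊛ x) → ¬ (+ p ∣ₛ g s) → pO x
  nonroot s {x} h p∤g = annihilated-by-root⇒pO s h
    ([ id , ⊥-elim ∘ p∤g ]′ (euclid pr (x₃ x) (g s)
      (subst (λ w → + p ∣ₛ w) (ℤₚ.neg-involutive _) (Signed.∣m⇒∣-m (subst (λ w → + p ∣ₛ w) (ev-root-⊛ s x)
          (ev-pO s h))))))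

  ev-root : ∀ s → ev s (root s) ≡ 0ℤ
  ev-root s = trans (cong (ev s) (⊕-coordinates t ⌜ ℤ.- s ⌝))
    (solve 1 (λ s → con 0ℤ :+ :- s :+ s :* con 1ℤ :+ s :* s :* con 0ℤ :+ s :* s :* s :* con 0ℤ := con 0ℤ) refl s)

  π-cancel : ∀ n x → π ^ n ⊛ x ≡ 𝟘 → x ≡ 𝟘
  π-cancel zero    x h = trans (sym (⊛-identityˡ x)) h
  π-cancel (suc n) x h = π-cancel n x (⌜⌝-cancel (+ p) (trans (sym (⊛-assoc π (π ^ n) x)) h))
    where instance
      _ : ℤ.NonZero (+ p)
      _ = prime⇒nonZero pr

  -- With ξ = (τ - s) β / p, an integral equation for β / p makes a power of ξ a multiple of τ - s,
  -- whereas ξ(s) = - x₃(β) g(s) / p.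
  exact-root : ∀ s {β} → + p ∣ₛ g s → ¬ (+ (p ℕ.* p) ∣ₛ g s) → Integral β π → pO (root s ⊛ β) → pO β
  exact-root s {β} (divides w gs) p²∤g (as , eq) h@(ξ , ξ-eq) = annihilated-by-root⇒pO s h p∣x₃
    where
    -- Since β / π = ξ / (τ - s), an equation for the one is an equation for the other. Comparing
    -- the two scalings leaves only a power of π to cancel.
    hom-ξ : hom as ξ (root s) ≡ 𝟘
    hom-ξ = π-cancel (length as) _ (begin
      π ^ length as ⊛ hom as ξ (root s)     ≡⟨ sym (hom-scale π as ξ (root s)) ⟩
      hom as (π ⊛ ξ) (π ⊛ root s)           ≡⟨ cong₂ (hom as) (sym ξ-eq) (⊛-comm π (root s)) ⟩
      hom as (root s ⊛ β) (root s ⊛ π)      ≡⟨ hom-scale (root s) as β π ⟩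
      root s ^ length as ⊛ hom as β π       ≡⟨ cong (root s ^ length as ⊛_) eq ⟩
      root s ^ length as ⊛ 𝟘                ≡⟨ zeroʳ _ ⟩
      𝟘                                     ∎)
    p∣evξ : + p ∣ₛ ev s ξ
    p∣evξ =
      let n , y , ξⁿ = integral-power ξ (root s) (as , hom-ξ)
          z , eq′    = ev-⊛ s (root s) y
      in ev-power-cancel s n ξ (divides w gs) (divides (w ℤ.* z) (begin
        ev s (ξ ^ n)                                    ≡⟨ cong (ev s) ξⁿ ⟩
        ev s (root s ⊛ y)                               ≡⟨ eq′ ⟩
        ev s (root s) ℤ.* ev s y ℤ.+ g s ℤ.* z          ≡⟨ cong₂ (λ a b → a ℤ.* ev s y ℤ.+ b ℤ.* z) (ev-root s) gs ⟩
        0ℤ ℤ.* ev s y ℤ.+ w ℤ.* + p ℤ.* z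
          ≡⟨ solve 4 (λ e w p z → con 0ℤ :* e :+ w :* p :* z := w :* z :* p) refl (ev s y) w (+ p) z ⟩
        w ℤ.* z ℤ.* + p                                 ∎))
    instance
      _ : ℤ.NonZero (+ p)
      _ = prime⇒nonZero pr
    evξ : ev s ξ ≡ ℤ.- (x₃ β ℤ.* w)
    evξ = ℤₚ.*-cancelˡ-≡ (+ p) _ _ (begin
      + p ℤ.* ev s ξ                 ≡⟨ sym (ev-⌜⌝⊛ s (+ p) ξ) ⟩
      ev s (π ⊛ ξ)                   ≡⟨ cong (ev s) (sym ξ-eq) ⟩
      ev s (root s ⊛ β)              ≡⟨ ev-root-⊛ s β ⟩
      ℤ.- (x₃ β ℤ.* g s)             ≡⟨ cong (λ z → ℤ.- (x₃ β ℤ.* z)) gs ⟩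
      ℤ.- (x₃ β ℤ.* (w ℤ.* + p))     ≡⟨ solve 3 (λ b w p → :- (b :* (w :* p)) := p :* :- (b :* w))
          refl (x₃ β) w (+ p) ⟩
      + p ℤ.* ℤ.- (x₃ β ℤ.* w)       ∎)
    p∤w : ¬ (+ p ∣ₛ w)
    p∤w (divides v refl) = p²∤g (divides v (trans gs (trans (ℤₚ.*-assoc v (+ p) (+ p)) (cong (v ℤ.*_)
        (sym (ℤₚ.pos-* p p))))))
    p∣x₃ : + p ∣ₛ x₃ β
    p∣x₃ = [ id , ⊥-elim ∘ p∤w ]′ (euclid pr (x₃ β) w
      (subst (λ z → + p ∣ₛ z) (trans (cong ℤ.-_ evξ) (ℤₚ.neg-involutive _)) (Signed.∣m⇒∣-m p∣evξ)))

inverse-mod : ∀ {p} → Prime p → ∀ u → ¬ (+ p ∣ₛ u) → ∃ λ w → ∃ λ y → w ℤ.* u ≡ 1ℤ ℤ.+ y ℤ.* + p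
inverse-mod {p} pr u p∤u = signed u refl (coprime-Bézout coprime)
  where
  coprime : Coprime ℤ.∣ u ∣ p
  coprime {e} (e∣u , e∣p) with prime⇒irreducible pr e∣p
  ... | inj₁ e≡1  = e≡1
  ... | inj₂ refl = ⊥-elim (p∤u (Signed.∣ᵤ⇒∣ e∣u))
  abs : Identity 1 ℤ.∣ u ∣ p → ∃ λ w → ∃ λ y → w ℤ.* + ℤ.∣ u ∣ ≡ 1ℤ ℤ.+ y ℤ.* + p
  abs (+- x y eq) = + x , + y , (begin
    + x ℤ.* + ℤ.∣ u ∣      ≡⟨ ℤₚ.pos-* x _ ⟨
    + (x ℕ.* ℤ.∣ u ∣)      ≡⟨ cong +_ eq ⟨
    + (1 ℕ.+ y ℕ.* p)      ≡⟨ cong (λ z → 1ℤ ℤ.+ z) (ℤₚ.pos-* y p) ⟩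
    1ℤ ℤ.+ + y ℤ.* + p     ∎)
    where open ≡-Reasoning
  abs (-+ x y eq) = ℤ.- + x , ℤ.- + y , (begin
    (ℤ.- + x) ℤ.* + ℤ.∣ u ∣
      ≡⟨ solve 2 (λ x u → (:- x) :* u := con 1ℤ :+ :- (con 1ℤ :+ x :* u)) refl (+ x) (+ ℤ.∣ u ∣) ⟩
    1ℤ ℤ.+ ℤ.- (1ℤ ℤ.+ + x ℤ.* + ℤ.∣ u ∣)
      ≡⟨ cong (λ z → 1ℤ ℤ.+ ℤ.- (1ℤ ℤ.+ z)) (ℤₚ.pos-* x _) ⟨
    1ℤ ℤ.+ ℤ.- (+ (1 ℕ.+ x ℕ.* ℤ.∣ u ∣))
      ≡⟨ cong (λ z → 1ℤ ℤ.+ ℤ.- (+ z)) eq ⟩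
    1ℤ ℤ.+ ℤ.- (+ (y ℕ.* p))
      ≡⟨ cong (λ z → 1ℤ ℤ.+ ℤ.- z) (ℤₚ.pos-* y p) ⟩
    1ℤ ℤ.+ ℤ.- (+ y ℤ.* + p)
      ≡⟨ cong (λ z → 1ℤ ℤ.+ z) (ℤₚ.neg-distribˡ-* (+ y) (+ p)) ⟩
    1ℤ ℤ.+ (ℤ.- + y) ℤ.* + p ∎)
    where open ≡-Reasoning
          open +-*-Solver
  signed : ∀ v → v ≡ u → Identity 1 ℤ.∣ u ∣ p → ∃ λ w → ∃ λ y → w ℤ.* u ≡ 1ℤ ℤ.+ y ℤ.* + p
  signed (+ n)      refl i = abs i
  signed ℤ.-[1+ n ] refl i with abs i
  ... | w , y , eq = ℤ.- w , y , trans (sym (ℤₚ.neg-distribˡ-* w _)) (trans (ℤₚ.neg-distribʳ-* w _) eq)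

-- Primes p that do not divide d, except p = 2 with c even

module SimpleRoots (c d : ℤ) {p : ℕ} (pr : Prime p)
  (p∤d : ¬ (+ p ∣ₛ d))
  (p∤2c : ¬ (+ p ∣ₛ + 2 × + p ∣ₛ c))
  (simple : ∀ s → + p ∣ₛ + 4 ℤ.* s ℤ.+ + 3 ℤ.* c → ¬ (+ (p ℕ.* p) ∣ₛ Roots.g c d s))
  where

  open Order c d
  open Integrality c d
  open Roots c d
  open Local c d pr
  open ≡-Reasoning
  open +-*-Solver using (solve; _:+_; _:*_; _:-_; :-_; con; _:=_)

  SquareZero : Quartic → Set
  SquareZero β = Integral β π × pO (β ⊛ β)

  squareZero-⊛ : ∀ z {β} → SquareZero β → SquareZero (z ⊛ β)
  squareZero-⊛ z {β} (int , sq) = integral-⊛ z β π int ,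
    subst pO (Q.solve 2 (λ z β → (z Q.:* z) Q.:* (β Q.:* β) Q.:= z Q.:* β Q.:* (z Q.:* β)) refl z β) (pO-⊛ (z ⊛ z) sq)

  -- If s is not a root of g modulo p, `nonroot` applies. If it is, then either p divides `x₃ β`, or
  -- s is a double root, where `simple` provides the hypothesis of `exact-root`.
  by-root : ∀ s {β} → SquareZero β → pO (root s ⊛ β) → pO β
  by-root s {β} (int , sq) h with + p Signed.∣? g s
  ... | no  p∤g = nonroot s h p∤g
  ... | yes p∣g = [ annihilated-by-root⇒pO s h , [ square , exact ]′ ∘ euclid pr (s ℤ.* s) _ ]′
                    (euclid pr (x₃ β) _ derivative)
    where
    -- Modulo p, β is `x₃ β` times (g(x) - g(s)) / (x - s), whose value at s is g′(s) = s² (4s +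
    -- 3c); and p divides β(s) because it divides β(s)². The weights -1, -2s and -3s² eliminate the
    -- lower coordinates from β(s).
    derivative : + p ∣ₛ x₃ β ℤ.* (s ℤ.* s ℤ.* (+ 4 ℤ.* s ℤ.+ + 3 ℤ.* c))
    derivative = let h₂ , h₁ , h₀ = annihilated-by-root s h in subst (λ z → + p ∣ₛ z)
      (solve 6 (λ c s a b e f →
         (a :+ s :* b :+ s :* s :* e :+ s :* s :* s :* f) :+
         (:- (a :- s :* b) :+ ((con (ℤ.- + 2) :* s) :* (b :- s :* e) :+ (con (ℤ.- + 3) :* (s :* s)) :* (e :- (c :+
             s) :* f))) :=
         f :* (s :* s :* (con (+ 4) :* s :+ con (+ 3) :* c))) refl c s (x₀ β) (x₁ β) (x₂ β) (x₃ β))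
      (Signed.∣m∣n⇒∣m+n ([ id , id ]′ (ev-⊛-cancel s β β p∣g (ev-pO s sq)))
        (Signed.∣m∣n⇒∣m+n (Signed.∣m⇒∣-m h₀)
          (Signed.∣m∣n⇒∣m+n (Signed.∣n⇒∣m*n ((ℤ.- + 2) ℤ.* s) h₁) (Signed.∣n⇒∣m*n ((ℤ.- + 3) ℤ.* (s ℤ.* s)) h₂))))
    p∤s : ¬ (+ p ∣ₛ s)
    p∤s p∣s = p∤d (∣-comb d 1ℤ (ℤ.- (s ℤ.* s ℤ.* s ℤ.+ c ℤ.* (s ℤ.* s))) p∣g p∣s
      (solve 3 (λ c d s → d := con 1ℤ :* (s :* s :* s :* s :+ c :* (s :* s :* s) :+ d) :+ :- (s :* s :* s :+
          c :* (s :* s)) :* s) refl c d s))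
    square : + p ∣ₛ s ℤ.* s → pO β
    square p∣s² = ⊥-elim ([ p∤s , p∤s ]′ (euclid pr s s p∣s²))
    exact : + p ∣ₛ + 4 ℤ.* s ℤ.+ + 3 ℤ.* c → pO β
    exact r = exact-root s p∣g (simple s r) int h

  -- If p divides u, the annihilator is the constant v modulo p, which is zero or a unit. Otherwise,
  -- with w inverse to u modulo p, it is a unit times τ - s for s = - w v.
  by-linear : ∀ u v {β} → SquareZero β → pO ((⌜ u ⌝ ⊛ t ⊕ ⌜ v ⌝) ⊛ β) → (+ p ∣ₛ u × + p ∣ₛ v) ⊎ pO β
  by-linear u v {β} nil h with + p Signed.∣? u
  ... | yes p∣u = [ (λ p∣v → inj₁ (p∣u , p∣v)) , inj₂ ]′ (unit (pO-comb _ 𝟙 (⊖ (t ⊛ β)) h (pO-const p∣u)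
    (Q.solve 4 (λ u v t β → v Q.:* β Q.:= Q.con 1ℤ Q.:* ((u Q.:* t Q.:+ v) Q.:* β) Q.:+ Q.:- (t Q.:* β) Q.:* u)
        refl ⌜ u ⌝ ⌜ v ⌝ t β)))
  ... | no p∤u with inverse-mod pr u p∤u
  ... | w , y , wu = inj₂ (by-root (ℤ.- (w ℤ.* v)) nil (pO-comb _ ⌜ w ⌝ (⊖ ⌜ y ⌝) h (pO-π (t ⊛ β)) (begin
    (t ⊕ ⌜ ℤ.- ℤ.- (w ℤ.* v) ⌝) ⊛ β
      ≡⟨ cong (λ z → (t ⊕ z) ⊛ β) (trans (cong ⌜_⌝ (ℤₚ.neg-involutive (w ℤ.* v))) (⌜⌝-* w v)) ⟩
    (t ⊕ ⌜ w ⌝ ⊛ ⌜ v ⌝) ⊛ β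
      ≡⟨ Q.solve 6 (λ t w v β y π → (t Q.:+ w Q.:* v) Q.:* β Q.:=
           ((Q.con 1ℤ Q.:+ y Q.:* π) Q.:* t Q.:+ w Q.:* v) Q.:* β Q.:+ Q.:- y Q.:* (π Q.:* (t Q.:* β)))
           refl t ⌜ w ⌝ ⌜ v ⌝ β ⌜ y ⌝ π ⟩
    ((𝟙 ⊕ ⌜ y ⌝ ⊛ π) ⊛ t ⊕ ⌜ w ⌝ ⊛ ⌜ v ⌝) ⊛ β ⊕ ⊖ ⌜ y ⌝ ⊛ (π ⊛ (t ⊛ β))
      ≡⟨ cong (λ z → (z ⊛ t ⊕ ⌜ w ⌝ ⊛ ⌜ v ⌝) ⊛ β ⊕ ⊖ ⌜ y ⌝ ⊛ (π ⊛ (t ⊛ β))) (sym (⌜⌝-inverse w u y wu)) ⟩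
    (⌜ w ⌝ ⊛ ⌜ u ⌝ ⊛ t ⊕ ⌜ w ⌝ ⊛ ⌜ v ⌝) ⊛ β ⊕ ⊖ ⌜ y ⌝ ⊛ (π ⊛ (t ⊛ β))
      ≡⟨ cong (_⊕ ⊖ ⌜ y ⌝ ⊛ (π ⊛ (t ⊛ β))) (Q.solve 5 (λ w u t v β → (w Q.:* u Q.:* t Q.:+ w Q.:* v) Q.:* β Q.:=
           w Q.:* ((u Q.:* t Q.:+ v) Q.:* β)) refl ⌜ w ⌝ ⌜ u ⌝ t ⌜ v ⌝ β) ⟩
    ⌜ w ⌝ ⊛ ((⌜ u ⌝ ⊛ t ⊕ ⌜ v ⌝) ⊛ β) ⊕ ⊖ ⌜ y ⌝ ⊛ (π ⊛ (t ⊛ β)) ∎)))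

  -- Long division of g by x² + S x + U. The coefficients c of x³ and 0 of x² determine S′ and U′,
  -- and as g(τ) = 0, what remains is minus the remainder. The coefficients enter through equations
  -- so that images of integer expressions can be supplied by `expand`.
  quotient-quadratic : ∀ {S U S′ U′ R₁ R₀} →
    S′ ≡ ⌜ c ⌝ ⊕ ⊖ S → U′ ≡ ⊖ U ⊕ ⊖ (S ⊛ S′) → R₁ ≡ S ⊛ U′ ⊕ S′ ⊛ U → R₀ ≡ U ⊛ U′ ⊕ ⊖ ⌜ d ⌝ →
    (t ⊛ t ⊕ S′ ⊛ t ⊕ U′) ⊛ (t ⊛ t ⊕ S ⊛ t ⊕ U) ≡ R₁ ⊛ t ⊕ R₀
  quotient-quadratic {S} {U} refl refl refl refl = trans
    (Q.solve 5 (λ c d t S U →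
           let S′ = c Q.:+ Q.:- S ; U′ = Q.:- U Q.:+ Q.:- (S Q.:* S′) in
           (t Q.:* t Q.:+ S′ Q.:* t Q.:+ U′) Q.:* (t Q.:* t Q.:+ S Q.:* t Q.:+ U) Q.:=
           (t Q.:* (t Q.:* (t Q.:* t)) Q.:+ c Q.:* (t Q.:* (t Q.:* t)) Q.:+ d) Q.:+
           ((S Q.:* U′ Q.:+ S′ Q.:* U) Q.:* t Q.:+ (U Q.:* U′ Q.:+ Q.:- d))) refl ⌜ c ⌝ ⌜ d ⌝ t S U)
    (minimal-⊕ _)

  -- The same division by a monic cubic: the quotient is x - S, with S determined by the coefficient
  -- c of x³.
  quotient-cubic : ∀ {A B E S R₂ R₁ R₀} →
    S ≡ E ⊕ ⊖ ⌜ c ⌝ → R₂ ≡ B ⊕ ⊖ S ⊛ E → R₁ ≡ A ⊕ ⊖ S ⊛ B → R₀ ≡ ⊖ S ⊛ A ⊕ ⊖ ⌜ d ⌝ →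
    (t ⊕ ⊖ S) ⊛ (A ⊕ B ⊛ t ⊕ E ⊛ (t ⊛ t) ⊕ t ⊛ (t ⊛ t)) ≡ R₂ ⊛ (t ⊛ t) ⊕ R₁ ⊛ t ⊕ R₀
  quotient-cubic {A} {B} {E} refl refl refl refl = trans
    (Q.solve 6 (λ c d t A B E →
           let S = E Q.:+ Q.:- c in
           (t Q.:+ Q.:- S) Q.:* (A Q.:+ B Q.:* t Q.:+ E Q.:* (t Q.:* t) Q.:+ t Q.:* (t Q.:* t)) Q.:=
           (t Q.:* (t Q.:* (t Q.:* t)) Q.:+ c Q.:* (t Q.:* (t Q.:* t)) Q.:+ d) Q.:+
           ((B Q.:+ Q.:- S Q.:* E) Q.:* (t Q.:* t) Q.:+ (A Q.:+ Q.:- S Q.:* B) Q.:* t Q.:+ (Q.:- S Q.:* A Q.:+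
               Q.:- d))) refl ⌜ c ⌝ ⌜ d ⌝ t A B E)
    (minimal-⊕ _)

  -- Let e be the quotient of g by k. The remainders of g and of β on division by k are linear and
  -- annihilate β, because k, g and β itself do; so unless β ∈ p ℤ[τ], both vanish modulo p. Then β
  -- ≡ m k and e k ≡ g, so e annihilates β as well, and so does the linear polynomial e - k. Its
  -- vanishing modulo p would give g ≡ k².
  by-monic-quadratic : ∀ s u {β} → SquareZero β → pO ((t ⊛ t ⊕ ⌜ s ⌝ ⊛ t ⊕ ⌜ u ⌝) ⊛ β) → pO β
  by-monic-quadratic s u {β} nil@(int , sq) kβ = [ remainder≡0 , id ]′ (by-linear ρ₁ ρ₀ nil
      (subst pO (trans (sym (⊛-assoc e k β)) (cong (_⊛ β) ek)) (pO-⊛ e kβ)))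
    where
    b₀ = x₀ β
    b₁ = x₁ β
    b₂ = x₂ β
    b₃ = x₃ β
    s′ = c ℤ.- s
    u′ = ℤ.- u ℤ.- s ℤ.* s′
    ρ₁ = s ℤ.* u′ ℤ.+ s′ ℤ.* u
    ρ₀ = u ℤ.* u′ ℤ.- d
    k = t ⊛ t ⊕ ⌜ s ⌝ ⊛ t ⊕ ⌜ u ⌝
    e = t ⊛ t ⊕ ⌜ s′ ⌝ ⊛ t ⊕ ⌜ u′ ⌝
    ek : e ⊛ k ≡ ⌜ ρ₁ ⌝ ⊛ t ⊕ ⌜ ρ₀ ⌝
    ek = quotient-quadratic
      (expand (Q.var 0F Q.:- Q.var 1F) (c ∷ s ∷ []))
      (expand (Q.:- Q.var 0F Q.:- Q.var 1F Q.:* Q.var 2F) (u ∷ s ∷ s′ ∷ []))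
      (expand (Q.var 0F Q.:* Q.var 1F Q.:+ Q.var 2F Q.:* Q.var 3F) (s ∷ u′ ∷ s′ ∷ u ∷ []))
      (expand (Q.var 0F Q.:* Q.var 1F Q.:- Q.var 2F) (u ∷ u′ ∷ d ∷ []))
    m₀ = b₂ ℤ.- s ℤ.* b₃
    σ₁ = b₁ ℤ.- s ℤ.* m₀ ℤ.- u ℤ.* b₃
    σ₀ = b₀ ℤ.- u ℤ.* m₀
    m = ⌜ b₃ ⌝ ⊛ t ⊕ ⌜ m₀ ⌝
    σ = ⌜ σ₁ ⌝ ⊛ t ⊕ ⌜ σ₀ ⌝
    division : β ≡ m ⊛ k ⊕ σ
    division = begin
      β ≡⟨ basis β ⟩
      ⌜ b₀ ⌝ ⊕ ⌜ b₁ ⌝ ⊛ t ⊕ ⌜ b₂ ⌝ ⊛ (t ⊛ t) ⊕ ⌜ b₃ ⌝ ⊛ (t ⊛ (t ⊛ t))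
        ≡⟨ Q.solve 7 (λ b₀ b₁ b₂ b₃ t s u →
             let m₀ = b₂ Q.:- s Q.:* b₃ in
             b₀ Q.:+ b₁ Q.:* t Q.:+ b₂ Q.:* (t Q.:* t) Q.:+ b₃ Q.:* (t Q.:* (t Q.:* t)) Q.:=
             (b₃ Q.:* t Q.:+ m₀) Q.:* (t Q.:* t Q.:+ s Q.:* t Q.:+ u) Q.:+
             ((b₁ Q.:- s Q.:* m₀ Q.:- u Q.:* b₃) Q.:* t Q.:+ (b₀ Q.:- u Q.:* m₀)))
             refl ⌜ b₀ ⌝ ⌜ b₁ ⌝ ⌜ b₂ ⌝ ⌜ b₃ ⌝ t ⌜ s ⌝ ⌜ u ⌝ ⟩
      _ ≡⟨ cong₂ (λ x y → (⌜ b₃ ⌝ ⊛ t ⊕ x) ⊛ k ⊕ y)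
             (sym (expand (Q.var 0F Q.:- Q.var 1F Q.:* Q.var 2F) (b₂ ∷ s ∷ b₃ ∷ [])))
             (sym (cong₂ (λ x y → x ⊛ t ⊕ y)
               (expand (Q.var 0F Q.:- Q.var 1F Q.:* (Q.var 2F Q.:- Q.var 1F Q.:* Q.var 3F) Q.:- Q.var 4F Q.:* Q.var 3F) (b₁ ∷ s ∷ b₂ ∷ b₃ ∷ u ∷ []))
               (expand (Q.var 0F Q.:- Q.var 1F Q.:* (Q.var 2F Q.:- Q.var 3F Q.:* Q.var 4F)) (b₀ ∷ u ∷ b₂ ∷ s ∷ b₃ ∷ [])))) ⟩
      m ⊛ k ⊕ σ ∎
    σβ : pO (σ ⊛ β)
    σβ = pO-comb _ 𝟙 (⊖ m) sq kβ (begin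
      σ ⊛ β
        ≡⟨ Q.solve 4 (λ σ m k β → σ Q.:* β Q.:= Q.con 1ℤ Q.:* ((m Q.:* k Q.:+ σ) Q.:* β) Q.:+
            Q.:- m Q.:* (k Q.:* β)) refl σ m k β ⟩
      𝟙 ⊛ ((m ⊛ k ⊕ σ) ⊛ β) ⊕ ⊖ m ⊛ (k ⊛ β)
        ≡⟨ cong (λ z → 𝟙 ⊛ (z ⊛ β) ⊕ ⊖ m ⊛ (k ⊛ β)) (sym division) ⟩
      𝟙 ⊛ (β ⊛ β) ⊕ ⊖ m ⊛ (k ⊛ β) ∎)

    -- Compare g with (x² + s x + u)² modulo p. The coefficient of x gives 2su ≡ 0. But u ≡ 0 would
    -- give p ∣ d; 2 ≡ 0 would give c ≡ 2s ≡ 0; and s ≡ 0 would give 2u ≡ 0 from the coefficient of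
    -- x².
    contradiction : + p ∣ₛ ρ₁ → + p ∣ₛ ρ₀ → + p ∣ₛ s′ ℤ.- s → + p ∣ₛ u′ ℤ.- u → pO β
    contradiction p∣ρ₁ p∣ρ₀ p∣s′-s p∣u′-u = ⊥-elim
      ([ p∤2 , [ p∤s , p∤u ]′ ∘ euclid pr s u ]′ (euclid pr (+ 2) (s ℤ.* u)
        (subst (λ z → + p ∣ₛ z) (solve 4 (λ s u s′ u′ → (s :* u′ :+ s′ :* u) :+ (:- s :* (u′ :- u) :+
            :- u :* (s′ :- s)) := con (+ 2) :* (s :* u)) refl s u s′ u′)
          (Signed.∣m∣n⇒∣m+n p∣ρ₁ (Signed.∣m∣n⇒∣m+n (Signed.∣n⇒∣m*n (ℤ.- s) p∣u′-u) (Signed.∣n⇒∣m*n (ℤ.- u) p∣s′-s))))))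
      where
      p∤u : ¬ (+ p ∣ₛ u)
      p∤u p∣u = p∤d (∣-comb d u′ (ℤ.- 1ℤ) p∣u p∣ρ₀
        (solve 3 (λ d u u′ → d := u′ :* u :+ con (ℤ.- 1ℤ) :* (u :* u′ :- d)) refl d u u′))
      p∤2 : ¬ (+ p ∣ₛ + 2)
      p∤2 p∣2 = p∤2c (p∣2 , ∣-comb c 1ℤ s p∣s′-s p∣2 (solve 2 (λ c s → c :=
          con 1ℤ :* (c :- s :- s) :+ s :* con (+ 2)) refl c s))
      p∤s : ¬ (+ p ∣ₛ s)
      p∤s p∣s = [ p∤2 , p∤u ]′ (euclid pr (+ 2) u (∣-comb (+ 2 ℤ.* u) (ℤ.- 1ℤ) (ℤ.- s′) p∣u′-u p∣s
        (solve 3 (λ s s′ u → con (+ 2) :* u := con (ℤ.- 1ℤ) :* (:- u :- s :* s′ :- u) :+ :- s′ :* s) refl s s′ u)))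

    remainder≡0 : + p ∣ₛ ρ₁ × + p ∣ₛ ρ₀ → pO β
    remainder≡0 (p∣ρ₁ , p∣ρ₀) = [ σ≡0 , id ]′ (by-linear σ₁ σ₀ nil σβ)
      where
      σ≡0 : + p ∣ₛ σ₁ × + p ∣ₛ σ₀ → pO β
      σ≡0 (p∣σ₁ , p∣σ₀) = [ (λ (p∣s′-s , p∣u′-u) → contradiction p∣ρ₁ p∣ρ₀ p∣s′-s p∣u′-u) , id ]′
        (by-linear (s′ ℤ.- s) (u′ ℤ.- u) nil (pO-comb _ 𝟙 (⊖ 𝟙) eβ kβ (begin
          (⌜ s′ ℤ.- s ⌝ ⊛ t ⊕ ⌜ u′ ℤ.- u ⌝) ⊛ β
            ≡⟨ cong₂ (λ x y → (x ⊛ t ⊕ y) ⊛ β) (expand (Q.var 0F Q.:- Q.var 1F) (s′ ∷ s ∷ []))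
                (expand (Q.var 0F Q.:- Q.var 1F) (u′ ∷ u ∷ [])) ⟩
          ((⌜ s′ ⌝ ⊕ ⊖ ⌜ s ⌝) ⊛ t ⊕ (⌜ u′ ⌝ ⊕ ⊖ ⌜ u ⌝)) ⊛ β
            ≡⟨ Q.solve 6 (λ S′ S U′ U t β → ((S′ Q.:+ Q.:- S) Q.:* t Q.:+ (U′ Q.:+ Q.:- U)) Q.:* β Q.:=
                 Q.con 1ℤ Q.:* ((t Q.:* t Q.:+ S′ Q.:* t Q.:+ U′) Q.:* β) Q.:+ Q.:- Q.con 1ℤ Q.:* ((t Q.:* t Q.:+
                     S Q.:* t Q.:+ U) Q.:* β))
                 refl ⌜ s′ ⌝ ⌜ s ⌝ ⌜ u′ ⌝ ⌜ u ⌝ t β ⟩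
          𝟙 ⊛ (e ⊛ β) ⊕ ⊖ 𝟙 ⊛ (k ⊛ β) ∎)))
        where
        eβ : pO (e ⊛ β)
        eβ = pO-comb _ m e (pO-linear p∣ρ₁ p∣ρ₀) (pO-linear p∣σ₁ p∣σ₀) (begin
          e ⊛ β                  ≡⟨ cong (e ⊛_) division ⟩
          e ⊛ (m ⊛ k ⊕ σ)        ≡⟨ Q.solve 4 (λ e m k σ → e Q.:* (m Q.:* k Q.:+ σ) Q.:=
              m Q.:* (e Q.:* k) Q.:+ e Q.:* σ) refl e m k σ ⟩
          m ⊛ (e ⊛ k) ⊕ e ⊛ σ    ≡⟨ cong (λ z → m ⊛ z ⊕ e ⊛ σ) ek ⟩
          _                      ∎)

  by-quadratic : ∀ w u v {β} → SquareZero β → pO ((⌜ w ⌝ ⊛ (t ⊛ t) ⊕ ⌜ u ⌝ ⊛ t ⊕ ⌜ v ⌝) ⊛ β) →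
    (+ p ∣ₛ w × + p ∣ₛ u × + p ∣ₛ v) ⊎ pO β
  by-quadratic w u v {β} nil h with + p Signed.∣? w
  ... | yes p∣w = [ (λ (p∣u , p∣v) → inj₁ (p∣w , p∣u , p∣v)) , inj₂ ]′ (by-linear u v nil
    (pO-comb _ 𝟙 (⊖ (t ⊛ t ⊛ β)) h (pO-const p∣w)
      (Q.solve 5 (λ w u v t β → (u Q.:* t Q.:+ v) Q.:* β Q.:=
        Q.con 1ℤ Q.:* ((w Q.:* (t Q.:* t) Q.:+ u Q.:* t Q.:+ v) Q.:* β) Q.:+ Q.:- (t Q.:* t Q.:* β) Q.:* w)
        refl ⌜ w ⌝ ⌜ u ⌝ ⌜ v ⌝ t β)))
  ... | no p∤w with inverse-mod pr w p∤w
  ... | x , y , xw = inj₂ (by-monic-quadratic (x ℤ.* u) (x ℤ.* v) nil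
    (pO-comb _ ⌜ x ⌝ (⊖ ⌜ y ⌝) h (pO-π (t ⊛ t ⊛ β)) (begin
      (t ⊛ t ⊕ ⌜ x ℤ.* u ⌝ ⊛ t ⊕ ⌜ x ℤ.* v ⌝) ⊛ β
        ≡⟨ cong₂ (λ a b → (t ⊛ t ⊕ a ⊛ t ⊕ b) ⊛ β) (⌜⌝-* x u) (⌜⌝-* x v) ⟩
      (t ⊛ t ⊕ ⌜ x ⌝ ⊛ ⌜ u ⌝ ⊛ t ⊕ ⌜ x ⌝ ⊛ ⌜ v ⌝) ⊛ β
        ≡⟨ Q.solve 7 (λ x u v t β y π → (t Q.:* t Q.:+ x Q.:* u Q.:* t Q.:+ x Q.:* v) Q.:* β Q.:=
             ((Q.con 1ℤ Q.:+ y Q.:* π) Q.:* (t Q.:* t) Q.:+ x Q.:* u Q.:* t Q.:+ x Q.:* v) Q.:* β Q.:+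
                 Q.:- y Q.:* (π Q.:* (t Q.:* t Q.:* β)))
             refl ⌜ x ⌝ ⌜ u ⌝ ⌜ v ⌝ t β ⌜ y ⌝ π ⟩
      ((𝟙 ⊕ ⌜ y ⌝ ⊛ π) ⊛ (t ⊛ t) ⊕ ⌜ x ⌝ ⊛ ⌜ u ⌝ ⊛ t ⊕ ⌜ x ⌝ ⊛ ⌜ v ⌝) ⊛ β ⊕ ⊖ ⌜ y ⌝ ⊛ (π ⊛ (t ⊛ t ⊛ β))
        ≡⟨ cong (λ z → (z ⊛ (t ⊛ t) ⊕ ⌜ x ⌝ ⊛ ⌜ u ⌝ ⊛ t ⊕ ⌜ x ⌝ ⊛ ⌜ v ⌝) ⊛ β ⊕ ⊖ ⌜ y ⌝ ⊛ (π ⊛ (t ⊛ t ⊛ β)))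
            (sym (⌜⌝-inverse x w y xw)) ⟩
      (⌜ x ⌝ ⊛ ⌜ w ⌝ ⊛ (t ⊛ t) ⊕ ⌜ x ⌝ ⊛ ⌜ u ⌝ ⊛ t ⊕ ⌜ x ⌝ ⊛ ⌜ v ⌝) ⊛ β ⊕ ⊖ ⌜ y ⌝ ⊛ (π ⊛ (t ⊛ t ⊛ β))
        ≡⟨ cong (_⊕ ⊖ ⌜ y ⌝ ⊛ (π ⊛ (t ⊛ t ⊛ β))) (Q.solve 6 (λ x w u v t β →
             (x Q.:* w Q.:* (t Q.:* t) Q.:+ x Q.:* u Q.:* t Q.:+ x Q.:* v) Q.:* β Q.:=
             x Q.:* ((w Q.:* (t Q.:* t) Q.:+ u Q.:* t Q.:+ v) Q.:* β)) refl ⌜ x ⌝ ⌜ w ⌝ ⌜ u ⌝ ⌜ v ⌝ t β) ⟩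
      ⌜ x ⌝ ⊛ ((⌜ w ⌝ ⊛ (t ⊛ t) ⊕ ⌜ u ⌝ ⊛ t ⊕ ⌜ v ⌝) ⊛ β) ⊕ ⊖ ⌜ y ⌝ ⊛ (π ⊛ (t ⊛ t ⊛ β)) ∎)))

  -- γ and k agree modulo p, so γ² ∈ p ℤ[τ] makes k, and hence every multiple r k, annihilate γ.
  remainder-annihilates : ∀ {r k γ ρ} z → r ⊛ k ≡ ρ → γ ≡ k ⊕ π ⊛ z → pO (γ ⊛ γ) → pO (ρ ⊛ γ)
  remainder-annihilates {r} {k} {γ} z refl eq γγ = pO-comb (r ⊛ k ⊛ γ) r (⊖ r) γγ (pO-π (z ⊛ γ)) (begin
    r ⊛ k ⊛ γ
      ≡⟨ Q.solve 5 (λ r k γ π z → r Q.:* k Q.:* γ Q.:=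
           r Q.:* ((k Q.:+ π Q.:* z) Q.:* γ) Q.:+ Q.:- r Q.:* (π Q.:* (z Q.:* γ))) refl r k γ π z ⟩
    r ⊛ ((k ⊕ π ⊛ z) ⊛ γ) ⊕ ⊖ r ⊛ (π ⊛ (z ⊛ γ))
      ≡⟨ cong (λ w → r ⊛ (w ⊛ γ) ⊕ ⊖ r ⊛ (π ⊛ (z ⊛ γ))) (sym eq) ⟩
    r ⊛ (γ ⊛ γ) ⊕ ⊖ r ⊛ (π ⊛ (z ⊛ γ)) ∎)

  -- Once p divides r k, the cofactor r alone annihilates γ, because γ is k modulo p.
  zero-remainder : ∀ {r k γ ρ} z → r ⊛ k ≡ ρ → γ ≡ k ⊕ π ⊛ z → pO ρ → pO (r ⊛ γ)
  zero-remainder {r} {k} z refl refl Pρ = subst pO (sym (⊛-distribˡ-⊕ r k (π ⊛ z))) (pO-⊕ Pρ (pO-⊛ r (pO-π z)))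

  pO-quadratic : ∀ {w u v} → + p ∣ₛ w → + p ∣ₛ u → + p ∣ₛ v → pO (⌜ w ⌝ ⊛ (t ⊛ t) ⊕ ⌜ u ⌝ ⊛ t ⊕ ⌜ v ⌝)
  pO-quadratic {w} {u} {v} p∣w p∣u p∣v = subst pO (sym (⊕-assoc (⌜ w ⌝ ⊛ (t ⊛ t)) (⌜ u ⌝ ⊛ t) ⌜ v ⌝))
    (pO-⊕ (subst pO (⊛-comm (t ⊛ t) ⌜ w ⌝) (pO-⊛ (t ⊛ t) (pO-const p∣w))) (pO-linear p∣u p∣v))

  -- β is a polynomial in τ of degree at most 3 that annihilates β modulo p.
  square-zero : ∀ {β} → SquareZero β → pO β
  square-zero {β} nil@(int , sq) with + p Signed.∣? x₃ β
  ... | yes p∣b₃ = [ (λ (p∣b₂ , p∣b₁ , p∣b₀) → coordinates⇒pO p∣b₀ p∣b₁ p∣b₂ p∣b₃) , id ]′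
    (by-quadratic (x₂ β) (x₁ β) (x₀ β) nil (pO-comb _ 𝟙 (⊖ (t ⊛ (t ⊛ t) ⊛ β)) sq (pO-const p∣b₃) (begin
      (⌜ x₂ β ⌝ ⊛ (t ⊛ t) ⊕ ⌜ x₁ β ⌝ ⊛ t ⊕ ⌜ x₀ β ⌝) ⊛ β
        ≡⟨ Q.solve 6 (λ a b e f t β → (e Q.:* (t Q.:* t) Q.:+ b Q.:* t Q.:+ a) Q.:* β Q.:=
             Q.con 1ℤ Q.:* ((a Q.:+ b Q.:* t Q.:+ e Q.:* (t Q.:* t) Q.:+ f Q.:* (t Q.:* (t Q.:* t))) Q.:* β) Q.:+
             Q.:- (t Q.:* (t Q.:* t) Q.:* β) Q.:* f) refl ⌜ x₀ β ⌝ ⌜ x₁ β ⌝ ⌜ x₂ β ⌝ ⌜ x₃ β ⌝ t β ⟩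
      _ ≡⟨ cong (λ z → 𝟙 ⊛ (z ⊛ β) ⊕ ⊖ (t ⊛ (t ⊛ t) ⊛ β) ⊛ ⌜ x₃ β ⌝) (sym (basis β)) ⟩
      𝟙 ⊛ (β ⊛ β) ⊕ ⊖ (t ⊛ (t ⊛ t) ⊛ β) ⊛ ⌜ x₃ β ⌝ ∎)))
  ... | no p∤b₃ with inverse-mod pr (x₃ β) p∤b₃
  ... | w , y , wb₃ = [ ⊥-elim ∘ p∤w , id ]′ (unit γ∈pO)
    where
    p∤w : ¬ (+ p ∣ₛ w)
    p∤w p∣w = p∤1 (∣-comb 1ℤ (x₃ β) (ℤ.- y) p∣w Signed.∣-refl
      (trans (solve 2 (λ y p → con 1ℤ := (con 1ℤ :+ y :* p) :+ (:- y) :* p) refl y (+ p))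
        (cong (λ z → z ℤ.+ (ℤ.- y) ℤ.* + p) (trans (sym wb₃) (ℤₚ.*-comm w (x₃ β))))))
    -- Multiplication by w makes β monic modulo p, so γ agrees with the monic cubic `k` up to a
    -- multiple of p. Dividing g by `k` leaves a linear quotient: either the remainder is a nonzero
    -- annihilator of degree at most 2, or x - s annihilates γ.
    γ = ⌜ w ⌝ ⊛ β
    nil-γ : SquareZero γ
    nil-γ = squareZero-⊛ ⌜ w ⌝ nil
    a₀ = w ℤ.* x₀ β
    a₁ = w ℤ.* x₁ β
    a₂ = w ℤ.* x₂ β
    k = ⌜ a₀ ⌝ ⊕ ⌜ a₁ ⌝ ⊛ t ⊕ ⌜ a₂ ⌝ ⊛ (t ⊛ t) ⊕ t ⊛ (t ⊛ t)
    z = ⌜ y ⌝ ⊛ (t ⊛ (t ⊛ t))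
    γ-k : γ ≡ k ⊕ π ⊛ z
    γ-k = begin
      ⌜ w ⌝ ⊛ β
        ≡⟨ cong (⌜ w ⌝ ⊛_) (basis β) ⟩
      _ ≡⟨ Q.solve 6 (λ w a b e f t → w Q.:* (a Q.:+ b Q.:* t Q.:+ e Q.:* (t Q.:* t) Q.:+
          f Q.:* (t Q.:* (t Q.:* t))) Q.:=
             w Q.:* a Q.:+ w Q.:* b Q.:* t Q.:+ w Q.:* e Q.:* (t Q.:* t) Q.:+ w Q.:* f Q.:* (t Q.:* (t Q.:* t)))
             refl ⌜ w ⌝ ⌜ x₀ β ⌝ ⌜ x₁ β ⌝ ⌜ x₂ β ⌝ ⌜ x₃ β ⌝ t ⟩
      ⌜ w ⌝ ⊛ ⌜ x₀ β ⌝ ⊕ ⌜ w ⌝ ⊛ ⌜ x₁ β ⌝ ⊛ t ⊕ ⌜ w ⌝ ⊛ ⌜ x₂ β ⌝ ⊛ (t ⊛ t) ⊕ ⌜ w ⌝ ⊛ ⌜ x₃ β ⌝ ⊛ (t ⊛ (t ⊛ t))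
        ≡⟨ cong₂ _⊕_ (cong₂ _⊕_ (cong₂ (λ a b → a ⊕ b ⊛ t) (⌜⌝-* w (x₀ β)) (⌜⌝-* w (x₁ β)))
            (cong (_⊛ (t ⊛ t)) (⌜⌝-* w (x₂ β))))
             (cong (_⊛ (t ⊛ (t ⊛ t))) (sym (⌜⌝-inverse w (x₃ β) y wb₃))) ⟨
      ⌜ a₀ ⌝ ⊕ ⌜ a₁ ⌝ ⊛ t ⊕ ⌜ a₂ ⌝ ⊛ (t ⊛ t) ⊕ (𝟙 ⊕ ⌜ y ⌝ ⊛ π) ⊛ (t ⊛ (t ⊛ t))
        ≡⟨ Q.solve 6 (λ a₀ a₁ a₂ y π t →
             a₀ Q.:+ a₁ Q.:* t Q.:+ a₂ Q.:* (t Q.:* t) Q.:+ (Q.con 1ℤ Q.:+ y Q.:* π) Q.:* (t Q.:* (t Q.:* t)) Q.:=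
             (a₀ Q.:+ a₁ Q.:* t Q.:+ a₂ Q.:* (t Q.:* t) Q.:+ t Q.:* (t Q.:* t)) Q.:+
                 π Q.:* (y Q.:* (t Q.:* (t Q.:* t))))
             refl ⌜ a₀ ⌝ ⌜ a₁ ⌝ ⌜ a₂ ⌝ ⌜ y ⌝ π t ⟩
      k ⊕ π ⊛ z ∎
    s = a₂ ℤ.- c
    ρ₂ = a₁ ℤ.+ (ℤ.- s) ℤ.* a₂
    ρ₁ = a₀ ℤ.+ (ℤ.- s) ℤ.* a₁
    ρ₀ = (ℤ.- s) ℤ.* a₀ ℤ.- d
    ρ = ⌜ ρ₂ ⌝ ⊛ (t ⊛ t) ⊕ ⌜ ρ₁ ⌝ ⊛ t ⊕ ⌜ ρ₀ ⌝
    root-k : root s ⊛ k ≡ ρ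
    root-k = trans (cong (λ z → (t ⊕ z) ⊛ k) (⌜⌝-neg s)) (quotient-cubic
      (expand (Q.var 0F Q.:- Q.var 1F) (a₂ ∷ c ∷ []))
      (expand (Q.var 0F Q.:+ (Q.:- Q.var 1F) Q.:* Q.var 2F) (a₁ ∷ s ∷ a₂ ∷ []))
      (expand (Q.var 0F Q.:+ (Q.:- Q.var 1F) Q.:* Q.var 2F) (a₀ ∷ s ∷ a₁ ∷ []))
      (expand ((Q.:- Q.var 0F) Q.:* Q.var 1F Q.:- Q.var 2F) (s ∷ a₀ ∷ d ∷ [])))
    γ∈pO : pO γ
    γ∈pO = [ (λ (p∣ρ₂ , p∣ρ₁ , p∣ρ₀) →
               by-root s nil-γ (zero-remainder z root-k γ-k (pO-quadratic p∣ρ₂ p∣ρ₁ p∣ρ₀))) , id ]′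
      (by-quadratic ρ₂ ρ₁ ρ₀ nil-γ (remainder-annihilates z root-k γ-k (proj₂ nil-γ)))

  -- For n ≥ 2, if βⁿ ∈ p ℤ[τ] then the square of βⁿ⁻¹ is in p ℤ[τ] too, and βⁿ⁻¹ / p is integral as
  -- a multiple of β / p. So `square-zero` lowers the exponent by one.
  nilpotent : ∀ n {β} → Integral β π → pO (β ^ n) → pO β
  nilpotent zero    {β} int h = subst pO (*-identityʳ β) (pO-⊛ β h)
  nilpotent (suc zero) {β} int h = subst pO (*-identityʳ β) h
  nilpotent (suc (suc n)) {β} int h = nilpotent (suc n) int (square-zero (int′ , sq))
    where
    int′ : Integral (β ^ suc n) π
    int′ = subst (λ z → Integral z π) (⊛-comm (β ^ n) β) (integral-⊛ (β ^ n) β π int)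
    sq : pO (β ^ suc n ⊛ β ^ suc n)
    sq = subst pO (Q.solve 2 (λ β b → b Q.:* (β Q.:* (β Q.:* b)) Q.:= (β Q.:* b) Q.:* (β Q.:* b))
        refl β (β ^ n)) (pO-⊛ (β ^ n) h)

  integral⇒pO : ∀ {β} → Integral β π → pO β
  integral⇒pO {β} int = let n , h = integral-power β π int in nilpotent n int h

-- Primes dividing d, and p = 2 with c even and d odd

module RamifiedPrimes (c d : ℤ) {p : ℕ} (pr : Prime p) where

  open Order c d
  open Integrality c d
  open Roots c d
  open Local c d pr
  open ≡-Reasoning
  open +-*-Solver using (solve; _:+_; _:*_; _:-_; :-_; con; _:=_)

  module _ (s : ℤ) (p∣g : + p ∣ₛ g s) (p²∤g : ¬ (+ (p ℕ.* p) ∣ₛ g s)) where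

    -- One factor τ - s is removed at a time; what is left, (τ - s)ⁿ β, still has an integral
    -- quotient by p, so `exact-root` applies to it.
    by-root-power : ∀ n {β} → Integral β π → pO (root s ^ n ⊛ β) → pO β
    by-root-power zero    int h = subst pO (⊛-identityˡ _) h
    by-root-power (suc n) {β} int h = by-root-power n int
      (exact-root s p∣g p²∤g (integral-⊛ (root s ^ n) β π int) (subst pO (⊛-assoc (root s) (root s ^ n) β) h))

  -- Modulo p the polynomial g is x³ (x + c).
  integral⇒pO-∣d : + p ∣ₛ d → ¬ (+ (p ℕ.* p) ∣ₛ d) → ∀ {β} → Integral β π → pO β
  integral⇒pO-∣d p∣d p²∤d {β} int = by-root-power 0ℤ (subst (λ z → + p ∣ₛ z) (sym g0) p∣d) (p²∤d ∘ subst
      (λ z → + (p ℕ.* p) ∣ₛ z) g0) 3 int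
      (subst (λ z → pO (z ^ 3 ⊛ β)) (sym root0) (pO-comb _ (t ⊛ (t ⊛ t)) q (pO-const p∣σ) (pO-const p∣d) t³β))
    where
    g0 : g 0ℤ ≡ d
    g0 = solve 2 (λ c d → con 0ℤ :* con 0ℤ :* con 0ℤ :* con 0ℤ :+ c :* (con 0ℤ :* con 0ℤ :* con 0ℤ) :+ d := d)
        refl c d
    root0 : root 0ℤ ≡ t
    root0 = trans (⊕-comm t 𝟘) (⊕-identityˡ t)
    g[-c] : g (ℤ.- c) ≡ d
    g[-c] = solve 2 (λ c d → :- c :* :- c :* :- c :* :- c :+ c :* (:- c :* :- c :* :- c) :+ d := d) refl c d
    -- - c is a root of g modulo p, so β, being nilpotent modulo p, vanishes there. Hence x + c
    -- divides β modulo p, and x³ β is a multiple of x³ (x + c) ≡ g.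
    p∣σ : + p ∣ₛ ev (ℤ.- c) β
    p∣σ = let n , h = integral-power β π int in ev-power-cancel (ℤ.- c) n β (subst (λ z → + p ∣ₛ z)
        (sym g[-c]) p∣d) (ev-pO (ℤ.- c) h)
    B₁ = ⌜ x₁ β ⌝
    B₂ = ⌜ x₂ β ⌝
    B₃ = ⌜ x₃ β ⌝
    C = ⌜ c ⌝
    -- `m` is (β(x) - β(-c)) / (x + c), and `q` is -m. From x³ (x + c) = g - d one obtains x³ β = g
    -- m + x³ β(-c) - d m.
    q = ⊖ B₁ ⊕ B₂ ⊛ (C ⊕ ⊖ t) ⊕ B₃ ⊛ (C ⊛ t ⊕ ⊖ (C ⊛ C) ⊕ ⊖ (t ⊛ t))
    m = B₁ ⊕ B₂ ⊛ (t ⊕ ⊖ C) ⊕ B₃ ⊛ (t ⊛ t ⊕ ⊖ (C ⊛ t) ⊕ C ⊛ C)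
    t³β : t ^ 3 ⊛ β ≡ t ⊛ (t ⊛ t) ⊛ ⌜ ev (ℤ.- c) β ⌝ ⊕ q ⊛ ⌜ d ⌝
    t³β = begin
      t ^ 3 ⊛ β
        ≡⟨ cong (t ^ 3 ⊛_) (basis β) ⟩
      _ ≡⟨ Q.solve 7 (λ c d t b₀ b₁ b₂ b₃ →
             let m = b₁ Q.:+ b₂ Q.:* (t Q.:+ Q.:- c) Q.:+ b₃ Q.:* (t Q.:* t Q.:+ Q.:- (c Q.:* t) Q.:+ c Q.:* c)
                 q = Q.:- b₁ Q.:+ b₂ Q.:* (c Q.:+ Q.:- t) Q.:+ b₃ Q.:* (c Q.:* t Q.:+ Q.:- (c Q.:* c) Q.:+
                     Q.:- (t Q.:* t)) in
             t Q.:* (t Q.:* (t Q.:* Q.con 1ℤ)) Q.:* (b₀ Q.:+ b₁ Q.:* t Q.:+ b₂ Q.:* (t Q.:* t) Q.:+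
                 b₃ Q.:* (t Q.:* (t Q.:* t))) Q.:=
             (t Q.:* (t Q.:* (t Q.:* t)) Q.:+ c Q.:* (t Q.:* (t Q.:* t)) Q.:+ d) Q.:* m Q.:+
             (t Q.:* (t Q.:* t) Q.:* (b₀ Q.:+ Q.:- c Q.:* b₁ Q.:+ Q.:- c Q.:* Q.:- c Q.:* b₂ Q.:+
                 Q.:- c Q.:* Q.:- c Q.:* Q.:- c Q.:* b₃) Q.:+
              q Q.:* d)) refl C ⌜ d ⌝ t ⌜ x₀ β ⌝ B₁ B₂ B₃ ⟩
      _ ≡⟨ minimal-⊛ m _ ⟩
      _ ≡⟨ cong (λ z → t ⊛ (t ⊛ t) ⊛ z ⊕ q ⊛ ⌜ d ⌝) (sym (expand
             (Q.var 1F Q.:+ Q.:- Q.var 0F Q.:* Q.var 2F Q.:+ Q.:- Q.var 0F Q.:* Q.:- Q.var 0F Q.:* Q.var 3F Q.:+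
              Q.:- Q.var 0F Q.:* Q.:- Q.var 0F Q.:* Q.:- Q.var 0F Q.:* Q.var 4F) (c ∷ x₀ β ∷ x₁ β ∷ x₂ β ∷ x₃ β ∷ []))) ⟩
      t ⊛ (t ⊛ t) ⊛ ⌜ ev (ℤ.- c) β ⌝ ⊕ q ⊛ ⌜ d ⌝ ∎

  -- Modulo 2 the polynomial g is (x - 1)⁴.
  integral⇒pO-2 : + p ∣ₛ + 2 → + p ∣ₛ c → + p ∣ₛ 1ℤ ℤ.- d → + p ∣ₛ g 1ℤ → ¬ (+ (p ℕ.* p) ∣ₛ g 1ℤ) →
    ∀ {β} → Integral β π → pO β
  integral⇒pO-2 p∣2 p∣c p∣1-d p∣g p²∤g {β} int = by-root-power 1ℤ p∣g p²∤g 4 int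
      (subst pO (⊛-comm β _) (pO-⊛ β (pO-comb (root 1ℤ ^ 4) q 𝟙 (pO-const p∣2)
        (pO-⊕ (pO-⊛ (⊖ (t ⊛ (t ⊛ t))) (pO-const p∣c)) (pO-const p∣1-d)) eq)))
    where
    -- (x - 1)⁴ - g = (-4 - c) x³ + 6x² - 4x + (1 - d), and `q` is half of -4x³ + 6x² - 4x.
    q : Quartic
    q = ⌜ + 2 ⌝ ⊛ (⊖ (t ⊛ (t ⊛ t)) ⊕ ⊖ t) ⊕ ⌜ + 3 ⌝ ⊛ (t ⊛ t)
    eq : root 1ℤ ^ 4 ≡ q ⊛ ⌜ + 2 ⌝ ⊕ 𝟙 ⊛ (⊖ (t ⊛ (t ⊛ t)) ⊛ ⌜ c ⌝ ⊕ ⌜ 1ℤ ℤ.- d ⌝)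
    eq = begin
      root 1ℤ ^ 4
        ≡⟨ Q.solve 3 (λ c d t →
             let r = t Q.:+ Q.con (ℤ.- 1ℤ)
                 q = Q.con (+ 2) Q.:* (Q.:- (t Q.:* (t Q.:* t)) Q.:+ Q.:- t) Q.:+ Q.con (+ 3) Q.:* (t Q.:* t) in
             r Q.:* (r Q.:* (r Q.:* (r Q.:* Q.con 1ℤ))) Q.:=
             (t Q.:* (t Q.:* (t Q.:* t)) Q.:+ c Q.:* (t Q.:* (t Q.:* t)) Q.:+ d) Q.:+
             (q Q.:* Q.con (+ 2) Q.:+ Q.con 1ℤ Q.:* (Q.:- (t Q.:* (t Q.:* t)) Q.:* c Q.:+ (Q.con 1ℤ Q.:+ Q.:- d))))
             refl ⌜ c ⌝ ⌜ d ⌝ t ⟩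
      _ ≡⟨ minimal-⊕ _ ⟩
      _ ≡⟨ cong (λ z → q ⊛ ⌜ + 2 ⌝ ⊕ 𝟙 ⊛ (⊖ (t ⊛ (t ⊛ t)) ⊛ ⌜ c ⌝ ⊕ z)) (sym
          (expand (Q.con 1ℤ Q.:- Q.var 0F) (d ∷ []))) ⟩
      _ ∎

∣2⇒≡2 : ∀ {p} → Prime p → + p ∣ₛ + 2 → p ≡ 2
∣2⇒≡2 pr p∣2 with prime⇒irreducible prime[2] (Signed.∣⇒∣ᵤ p∣2)
... | inj₁ refl = ⊥-elim (¬prime[1] pr)
... | inj₂ p≡2  = p≡2

-- From single primes to arbitrary denominators

module Maximality (c d : ℤ)
  (squareFree : SquareFree d)
  (noOddSquare : NoOddPrimeSquareDivides (Δcd c d))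
  (at-2 : (+ 4) ∣ Δcd c d → ((c %ℕ 4 ≡ 0) × (d %ℕ 4 ≡ 1)) ⊎ ((c %ℕ 4 ≡ 2) × (d %ℕ 4 ≡ 3)))
  where

  open Order c d
  open Integrality c d
  open Roots c d
  open ≡-Reasoning
  open +-*-Solver using (solve; _:+_; _:*_; _:-_; :-_; con; _:=_)

  -- The value y = 0 corresponds to s = -3c/4, a zero of g′, so 256 g(s) written in powers of y has
  -- no linear term. Its constant term is `Δcd c d` and the rest is a multiple of y²; the factor 256
  -- = 4⁴ clears the denominators.
  p²∣Δ : ∀ {p} s → + p ∣ₛ + 4 ℤ.* s ℤ.+ + 3 ℤ.* c → + (p ℕ.* p) ∣ₛ g s → + (p ℕ.* p) ∣ₛ Δcd c d
  p²∣Δ {p} s (divides q y≡qp) p²∣g = subst (λ z → + (p ℕ.* p) ∣ₛ z)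
    (solve 3 (λ c d s → let y = con (+ 4) :* s :+ con (+ 3) :* c in
       con (+ 256) :* (s :* s :* s :* s :+ c :* (s :* s :* s) :+ d) :-
         (y :* y :- con (+ 8) :* c :* y :+ con (+ 18) :* (c :* c)) :* (y :* y) :=
       con (+ 256) :* d :- con (+ 27) :* (c :* c :* c :* c)) refl c d s)
    (Signed.∣m∣n⇒∣m-n (Signed.∣n⇒∣m*n (+ 256) p²∣g)
      (Signed.∣n⇒∣m*n (y ℤ.* y ℤ.- + 8 ℤ.* c ℤ.* y ℤ.+ + 18 ℤ.* (c ℤ.* c)) p²∣y²))
    where
    y = + 4 ℤ.* s ℤ.+ + 3 ℤ.* c
    p²∣y² : + (p ℕ.* p) ∣ₛ y ℤ.* y
    p²∣y² = divides (q ℤ.* q) (begin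
      y ℤ.* y                        ≡⟨ cong (λ z → z ℤ.* z) y≡qp ⟩
      (q ℤ.* + p) ℤ.* (q ℤ.* + p)    ≡⟨ solve 2 (λ q p → (q :* p) :* (q :* p) := q :* q :* (p :* p)) refl q (+ p) ⟩
      q ℤ.* q ℤ.* (+ p ℤ.* + p)      ≡⟨ cong (q ℤ.* q ℤ.*_) (sym (ℤₚ.pos-* p p)) ⟩
      q ℤ.* q ℤ.* + (p ℕ.* p)        ∎)

  -- Here g(1) = 1 + c + d is 2 modulo 4.
  integral⇒pO-at-2 : + 2 ∣ₛ c → ∀ {β} → Integral β ⌜ + 2 ⌝ → Local.pO c d prime[2] β
  integral⇒pO-at-2 2∣c@(divides q c≡q2) = residues (at-2 (Signed.∣⇒∣ᵤ 4∣Δ))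
    where
    -- An even c makes 4 divide 27c⁴, so the congruence condition on (c , d) becomes available.
    4∣Δ : + 4 ∣ₛ Δcd c d
    4∣Δ = divides (+ 64 ℤ.* d ℤ.- + 108 ℤ.* (q ℤ.* q ℤ.* q ℤ.* q)) (trans (cong (λ c → Δcd c d) c≡q2)
      (solve 2 (λ q d → let c = q :* con (+ 2) in
        con (+ 256) :* d :- con (+ 27) :* (c :* c :* c :* c) :=
        (con (+ 64) :* d :- con (+ 108) :* (q :* q :* q :* q)) :* con (+ 4)) refl q d))
    conclude : ∀ x → d ≡ 1ℤ ℤ.+ x ℤ.* + 2 → ∀ z → g 1ℤ ≡ + 2 ℤ.+ z ℤ.* + 4 →
      ∀ {β} → Integral β ⌜ + 2 ⌝ → Local.pO c d prime[2] β
    conclude x d≡ z g≡ = RamifiedPrimes.integral⇒pO-2 c d prime[2] Signed.∣-refl 2∣c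
      (divides (ℤ.- x) (trans (cong (λ d → 1ℤ ℤ.- d) d≡) (solve 1 (λ x → con 1ℤ :- (con 1ℤ :+ x :* con (+ 2)) :=
          :- x :* con (+ 2)) refl x)))
      (divides (1ℤ ℤ.+ z ℤ.* + 2) (trans g≡ (solve 1 (λ z → con (+ 2) :+ z :* con (+ 4) :=
          (con 1ℤ :+ z :* con (+ 2)) :* con (+ 2)) refl z)))
      (λ 4∣g → 4∤2 (Signed.∣m+n∣n⇒∣m (subst (λ w → + 4 ∣ₛ w) g≡ 4∣g) (divides z refl)))
      where
      4∤2 : ¬ (+ 4 ∣ₛ + 2)
      4∤2 h with Signed.∣⇒∣ᵤ h
      ... | ℕᵈ.divides zero ()
      ... | ℕᵈ.divides (suc _) ()
    residues : ((c %ℕ 4 ≡ 0) × (d %ℕ 4 ≡ 1)) ⊎ ((c %ℕ 4 ≡ 2) × (d %ℕ 4 ≡ 3)) →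
      ∀ {β} → Integral β ⌜ + 2 ⌝ → Local.pO c d prime[2] β
    residues (inj₁ (c%4 , d%4)) = conclude (d /ℕ 4 ℤ.* + 2)
      (trans d≡ (solve 1 (λ x → con 1ℤ :+ x :* con (+ 4) := con 1ℤ :+ x :* con (+ 2) :* con (+ 2)) refl (d /ℕ 4)))
      (c /ℕ 4 ℤ.+ d /ℕ 4)
      (trans (cong₂ (λ c d → 1ℤ ℤ.* 1ℤ ℤ.* 1ℤ ℤ.* 1ℤ ℤ.+ c ℤ.* (1ℤ ℤ.* 1ℤ ℤ.* 1ℤ) ℤ.+ d) c≡ d≡)
        (solve 2 (λ x y → con 1ℤ :* con 1ℤ :* con 1ℤ :* con 1ℤ :+ (con 0ℤ :+
            x :* con (+ 4)) :* (con 1ℤ :* con 1ℤ :* con 1ℤ) :+ (con 1ℤ :+ y :* con (+ 4)) :=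
           con (+ 2) :+ (x :+ y) :* con (+ 4)) refl (c /ℕ 4) (d /ℕ 4)))
      where
      c≡ : c ≡ 0ℤ ℤ.+ c /ℕ 4 ℤ.* + 4
      c≡ = trans (a≡a%ℕn+[a/ℕn]*n c 4) (cong (λ r → + r ℤ.+ c /ℕ 4 ℤ.* + 4) c%4)
      d≡ : d ≡ 1ℤ ℤ.+ d /ℕ 4 ℤ.* + 4
      d≡ = trans (a≡a%ℕn+[a/ℕn]*n d 4) (cong (λ r → + r ℤ.+ d /ℕ 4 ℤ.* + 4) d%4)
    residues (inj₂ (c%4 , d%4)) = conclude (1ℤ ℤ.+ d /ℕ 4 ℤ.* + 2)
      (trans d≡ (solve 1 (λ x → con (+ 3) :+ x :* con (+ 4) := con 1ℤ :+ (con 1ℤ :+ x :* con (+ 2)) :* con (+ 2))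
          refl (d /ℕ 4)))
      (1ℤ ℤ.+ c /ℕ 4 ℤ.+ d /ℕ 4)
      (trans (cong₂ (λ c d → 1ℤ ℤ.* 1ℤ ℤ.* 1ℤ ℤ.* 1ℤ ℤ.+ c ℤ.* (1ℤ ℤ.* 1ℤ ℤ.* 1ℤ) ℤ.+ d) c≡ d≡)
        (solve 2 (λ x y → con 1ℤ :* con 1ℤ :* con 1ℤ :* con 1ℤ :+ (con (+ 2) :+
            x :* con (+ 4)) :* (con 1ℤ :* con 1ℤ :* con 1ℤ) :+ (con (+ 3) :+ y :* con (+ 4)) :=
           con (+ 2) :+ (con 1ℤ :+ x :+ y) :* con (+ 4)) refl (c /ℕ 4) (d /ℕ 4)))
      where
      c≡ : c ≡ + 2 ℤ.+ c /ℕ 4 ℤ.* + 4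
      c≡ = trans (a≡a%ℕn+[a/ℕn]*n c 4) (cong (λ r → + r ℤ.+ c /ℕ 4 ℤ.* + 4) c%4)
      d≡ : d ≡ + 3 ℤ.+ d /ℕ 4 ℤ.* + 4
      d≡ = trans (a≡a%ℕn+[a/ℕn]*n d 4) (cong (λ r → + r ℤ.+ d /ℕ 4 ℤ.* + 4) d%4)

  integral-at-prime : ∀ {p} (pr : Prime p) {β} → Integral β ⌜ + p ⌝ → Local.pO c d pr β
  integral-at-prime {p} pr with + p Signed.∣? d
  ... | yes p∣d = RamifiedPrimes.integral⇒pO-∣d c d pr p∣d (squareFree p pr ∘ Signed.∣⇒∣ᵤ)
  ... | no  p∤d with p ℕₚ.≟ 2 | + p Signed.∣? c
  ... | yes refl | yes 2∣c = integral⇒pO-at-2 2∣c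
  -- For odd c the number 4s + 3c is odd, so the condition on double roots holds vacuously.
  ... | yes refl | no  2∤c = SimpleRoots.integral⇒pO c d pr p∤d (2∤c ∘ proj₂)
    (λ s 2∣y _ → 2∤c (∣-comb c 1ℤ (ℤ.- (+ 2 ℤ.* s ℤ.+ c)) 2∣y Signed.∣-refl
      (solve 2 (λ c s → c := con 1ℤ :* (con (+ 4) :* s :+ con (+ 3) :* c) :+ :- (con (+ 2) :* s :+ c) :* con (+ 2))
          refl c s)))
  ... | no  p≢2  | _       = SimpleRoots.integral⇒pO c d pr p∤d (p≢2 ∘ ∣2⇒≡2 pr ∘ proj₁)
    (λ s p∣y p²∣g → noOddSquare p pr p≢2 (Signed.∣⇒∣ᵤ (p²∣Δ s p∣y p²∣g)))

  -- With q the product of the remaining primes, β / p is q times β / (p q), hence integral, and so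
  -- β = p γ. Cancelling a power of p from the equation of β / (p q) gives one for γ / q.
  integral-over-product : ∀ {ps} → All Prime ps → ∀ {β} → Integral β ⌜ + product ps ⌝ → ∃ λ γ → β ≡ ⌜ + product ps ⌝ ⊛ γ
  integral-over-product []                 {β} _   = β , sym (⊛-identityˡ β)
  integral-over-product {p ∷ ps} (pr ∷ prs) {β} int =
    let γ , β≡   = integral-at-prime pr (integral-factor q β ⌜ + p ⌝ (subst (Integral β) (trans split
            (⊛-comm ⌜ + p ⌝ q)) int))
        as , eq  = subst₂ Integral β≡ split int
        δ , γ≡   = integral-over-product prs (as , Local.π-cancel c d pr (length as) _ (trans
            (sym (hom-scale ⌜ + p ⌝ as γ q)) eq))
    in δ , (begin
      β                                ≡⟨ β≡ ⟩
      ⌜ + p ⌝ ⊛ γ                      ≡⟨ cong (⌜ + p ⌝ ⊛_) γ≡ ⟩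
      ⌜ + p ⌝ ⊛ (q ⊛ δ)                ≡⟨ ⊛-assoc ⌜ + p ⌝ q δ ⟨
      ⌜ + p ⌝ ⊛ q ⊛ δ                  ≡⟨ cong (_⊛ δ) split ⟨
      ⌜ + (p ℕ.* product ps) ⌝ ⊛ δ     ∎)
    where
    q = ⌜ + product ps ⌝
    split : ⌜ + (p ℕ.* product ps) ⌝ ≡ ⌜ + p ⌝ ⊛ q
    split = trans (cong ⌜_⌝ (ℤₚ.pos-* p (product ps))) (⌜⌝-* (+ p) (+ product ps))

  integral-divides : ∀ n .{{_ : ℕ.NonZero n}} {β} → Integral β ⌜ + n ⌝ → ∃ λ γ → β ≡ ⌜ + n ⌝ ⊛ γ
  integral-divides n int with factorise n
  ... | record { factors = ps ; isFactorisation = refl ; factorsPrime = prs } = integral-over-product prs int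

-- Elements of ℤ[τ] are integral

module MonicRelation (c d : ℤ) where

  open Order c d
  open Integrality c d
  open Roots c d
  open ≡-Reasoning
  open Algebra.Properties.Semiring.Sum semiring using (sum)

  eval : Quartic → ∀ {k} → Vec ℤ k → Quartic
  eval a []      = 𝟘
  eval a (z ∷ v) = ⌜ z ⌝ ⊕ a ⊛ eval a v

  evalMonicₒ : List ℤ → Quartic → Quartic
  evalMonicₒ []      a = 𝟙
  evalMonicₒ (z ∷ f) a = ⌜ z ⌝ ⊕ a ⊛ evalMonicₒ f a

  module Span (a : Quartic) where

    -- The bound belongs to a chosen integer polynomial in `a`, of degree less than k, and not to x
    -- itself, which may have many such expressions. Degrees thus make sense even though `a` is
    -- algebraic.
    Below : ℕ → Quartic → Set
    Below k x = ∃ λ (v : Vec ℤ k) → x ≡ eval a v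

    Monic : ℕ → Quartic → Set
    Monic k x = Below k (x ⊕ ⊖ a ^ k)

    below-∷ : ∀ z {k x y} → Below k x → y ≡ ⌜ z ⌝ ⊕ a ⊛ x → Below (suc k) y
    below-∷ z (v , refl) eq = z ∷ v , eq

    below-𝟘 : ∀ k → Below k 𝟘
    below-𝟘 zero    = [] , refl
    below-𝟘 (suc k) = below-∷ 0ℤ (below-𝟘 k) (sym (trans (⊕-identityˡ _) (zeroʳ a)))

    below-suc : ∀ {k x} → Below k x → Below (suc k) x
    below-suc ([] , refl)    = below-𝟘 1
    below-suc (z ∷ v , refl) = below-∷ z (below-suc (v , refl)) refl

    below-+ˡ : ∀ j {k x} → Below k x → Below (j ℕ.+ k) x
    below-+ˡ zero    h = h
    below-+ˡ (suc j) h = below-suc (below-+ˡ j h)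

    below-⊕ : ∀ {k x y} → Below k x → Below k y → Below k (x ⊕ y)
    below-⊕ ([] , refl)    ([] , refl)    = [] , ⊕-identityˡ 𝟘
    below-⊕ (y ∷ v , refl) (z ∷ w , refl) = below-∷ (y ℤ.+ z) (below-⊕ (v , refl) (w , refl)) (begin
      (⌜ y ⌝ ⊕ a ⊛ eval a v) ⊕ (⌜ z ⌝ ⊕ a ⊛ eval a w)
        ≡⟨ Q.solve 5 (λ y z a v w → (y Q.:+ a Q.:* v) Q.:+ (z Q.:+ a Q.:* w) Q.:= (y Q.:+ z) Q.:+ a Q.:* (v Q.:+ w))
             refl ⌜ y ⌝ ⌜ z ⌝ a (eval a v) (eval a w) ⟩
      (⌜ y ⌝ ⊕ ⌜ z ⌝) ⊕ a ⊛ (eval a v ⊕ eval a w)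
        ≡⟨ cong (_⊕ a ⊛ (eval a v ⊕ eval a w)) (sym (⌜⌝-+ y z)) ⟩
      ⌜ y ℤ.+ z ⌝ ⊕ a ⊛ (eval a v ⊕ eval a w) ∎)

    below-⌜⌝⊛ : ∀ y {k x} → Below k x → Below k (⌜ y ⌝ ⊛ x)
    below-⌜⌝⊛ y ([] , refl)    = [] , zeroʳ ⌜ y ⌝
    below-⌜⌝⊛ y (z ∷ v , refl) = below-∷ (y ℤ.* z) (below-⌜⌝⊛ y (v , refl)) (begin
      ⌜ y ⌝ ⊛ (⌜ z ⌝ ⊕ a ⊛ eval a v)
        ≡⟨ Q.solve 4 (λ y z a v → y Q.:* (z Q.:+ a Q.:* v) Q.:= y Q.:* z Q.:+ a Q.:* (y Q.:* v))
            refl ⌜ y ⌝ ⌜ z ⌝ a (eval a v) ⟩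
      ⌜ y ⌝ ⊛ ⌜ z ⌝ ⊕ a ⊛ (⌜ y ⌝ ⊛ eval a v)
        ≡⟨ cong (_⊕ a ⊛ (⌜ y ⌝ ⊛ eval a v)) (sym (⌜⌝-* y z)) ⟩
      ⌜ y ℤ.* z ⌝ ⊕ a ⊛ (⌜ y ⌝ ⊛ eval a v) ∎)

    below-⊖ : ∀ {k x} → Below k x → Below k (⊖ x)
    below-⊖ {k} {x} h = subst (Below k)
      (Q.solve 1 (λ x → Q.con (ℤ.- 1ℤ) Q.:* x Q.:= Q.:- x) refl x) (below-⌜⌝⊛ (ℤ.- 1ℤ) h)

    below-a⊛ : ∀ {k x} → Below k x → Below (suc k) (a ⊛ x)
    below-a⊛ h = below-∷ 0ℤ h (sym (⊕-identityˡ _))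

    below-a^⊛ : ∀ j {k x} → Below k x → Below (j ℕ.+ k) (a ^ j ⊛ x)
    below-a^⊛ zero    {k} {x} h = subst (Below k) (sym (⊛-identityˡ x)) h
    below-a^⊛ (suc j) {k} {x} h = subst (Below (suc j ℕ.+ k)) (sym (⊛-assoc a (a ^ j) x)) (below-a⊛ (below-a^⊛ j h))

    below-⊛ : ∀ {j k x y} → Below j x → Below k y → Below (j ℕ.+ k) (x ⊛ y)
    below-⊛ {k = k} {y = y} ([] , refl) h = subst (Below k) (Q.solve 1 (λ y → Q.con 0ℤ Q.:= Q.con 0ℤ Q.:* y)
        refl y) (below-𝟘 k)
    below-⊛ {suc j} {k} {y = y} (z ∷ v , refl) h = subst (Below (suc j ℕ.+ k))
      (Q.solve 4 (λ z a v y → z Q.:* y Q.:+ a Q.:* (v Q.:* y) Q.:= (z Q.:+ a Q.:* v) Q.:* y)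
          refl ⌜ z ⌝ a (eval a v) y)
      (below-⊕ (below-+ˡ (suc j) (below-⌜⌝⊛ z h)) (below-a⊛ (below-⊛ (v , refl) h)))

    monic-⊛-below : ∀ {j k x y} → Monic j x → Below k y → Below (j ℕ.+ k) (x ⊛ y)
    monic-⊛-below {j} {k} {x} {y} m h = subst (Below (j ℕ.+ k))
      (Q.solve 3 (λ x y b → (x Q.:+ Q.:- b) Q.:* y Q.:+ b Q.:* y Q.:= x Q.:* y) refl x y (a ^ j))
      (below-⊕ (below-⊛ m h) (below-a^⊛ j h))

    monic-⊛ : ∀ {j k x y} → Monic j x → Monic k y → Monic (j ℕ.+ k) (x ⊛ y)
    monic-⊛ {j} {k} {x} {y} m n = subst (Below (j ℕ.+ k)) (begin
        x ⊛ (y ⊕ ⊖ a ^ k) ⊕ a ^ k ⊛ (x ⊕ ⊖ a ^ j)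
          ≡⟨ Q.solve 4 (λ x y b c → x Q.:* (y Q.:+ Q.:- c) Q.:+ c Q.:* (x Q.:+ Q.:- b) Q.:=
              x Q.:* y Q.:+ Q.:- (b Q.:* c)) refl x y (a ^ j) (a ^ k) ⟩
        x ⊛ y ⊕ ⊖ (a ^ j ⊛ a ^ k)
          ≡⟨ cong (λ z → x ⊛ y ⊕ ⊖ z) (sym (^-homo-* a j k)) ⟩
        x ⊛ y ⊕ ⊖ a ^ (j ℕ.+ k) ∎)
      (below-⊕ (monic-⊛-below m n) (subst (λ i → Below i (a ^ k ⊛ (x ⊕ ⊖ a ^ j))) (ℕₚ.+-comm k j) (below-a^⊛ k m)))

    monic-⊖-below : ∀ {k x y} → Monic k x → Below k y → Monic k (x ⊕ ⊖ y)
    monic-⊖-below {k} {x} {y} m h = subst (Below k)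
      (Q.solve 3 (λ x y b → (x Q.:+ Q.:- b) Q.:+ Q.:- y Q.:= (x Q.:+ Q.:- y) Q.:+ Q.:- b) refl x y (a ^ k))
      (below-⊕ m (below-⊖ h))

    sum-eliminate : ∀ n p q (x y v : Fin n → Quartic) →
      sum (λ j → (p ⊛ x j ⊕ ⊖ (q ⊛ y j)) ⊛ v j) ≡ p ⊛ sum (λ j → x j ⊛ v j) ⊕ ⊖ (q ⊛ sum (λ j → y j ⊛ v j))
    sum-eliminate zero    p q x y v = Q.solve 2 (λ p q → Q.con 0ℤ Q.:= p Q.:* Q.con 0ℤ Q.:+ Q.:- (q Q.:* Q.con 0ℤ))
        refl p q
    sum-eliminate (suc n) p q x y v = trans
      (cong ((p ⊛ x zero ⊕ ⊖ (q ⊛ y zero)) ⊛ v zero ⊕_) (sum-eliminate n p q (x ∘ suc) (y ∘ suc) (v ∘ suc)))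
      (Q.solve 7 (λ p q x y v s r → (p Q.:* x Q.:+ Q.:- (q Q.:* y)) Q.:* v Q.:+ (p Q.:* s Q.:+ Q.:- (q Q.:* r)) Q.:=
         p Q.:* (x Q.:* v Q.:+ s) Q.:+ Q.:- (q Q.:* (y Q.:* v Q.:+ r)))
         refl p q (x zero) (y zero) (v zero) (sum (λ j → x (suc j) ⊛ v (suc j))) (sum (λ j → y (suc j) ⊛ v (suc j))))

    -- The step N i j ↦ N 0 0 N i j - N i 0 N 0 j keeps the diagonal monic and of larger degree than the other entries.
    eliminate : ∀ n {k} (N : Fin (suc n) → Fin (suc n) → Quartic) (v : Fin (suc n) → Quartic) →
      (∀ i → Monic k (N i i)) → (∀ i j → i ≢ j → Below k (N i j)) → (∀ i → sum (λ j → N i j ⊛ v j) ≡ 𝟘) →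
      ∃ λ k′ → ∃ λ x → Monic k′ x × x ⊛ v (fromℕ n) ≡ 𝟘
    eliminate zero    {k} N v diag off rows = k , N zero zero , diag zero ,
      trans (Q.solve 1 (λ x → x Q.:= x Q.:+ Q.con 0ℤ) refl (N zero zero ⊛ v zero)) (rows zero)
    eliminate (suc n) {k} N v diag off rows = eliminate n {k ℕ.+ k}
      (λ i j → N zero zero ⊛ N (suc i) (suc j) ⊕ ⊖ (N (suc i) zero ⊛ N zero (suc j)))
      (v ∘ suc)
      (λ i → monic-⊖-below (monic-⊛ (diag zero) (diag (suc i))) (below-⊛ (off (suc i) zero λ ()) (off zero (suc i) λ ())))
      (λ i j i≢j → below-⊕ (monic-⊛-below (diag zero) (off (suc i) (suc j) (i≢j ∘ suc-injective)))
                           (below-⊖ (below-⊛ (off (suc i) zero λ ()) (off zero (suc j) λ ()))))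
      (λ i → begin
        sum (λ j → (N zero zero ⊛ N (suc i) (suc j) ⊕ ⊖ (N (suc i) zero ⊛ N zero (suc j))) ⊛ v (suc j))
          ≡⟨ sum-eliminate (suc n) (N zero zero) (N (suc i) zero) (N (suc i) ∘ suc) (N zero ∘ suc) (v ∘ suc) ⟩
        N zero zero ⊛ S (suc i) ⊕ ⊖ (N (suc i) zero ⊛ S zero)
          ≡⟨ Q.solve 5 (λ p q v s r → p Q.:* s Q.:+ Q.:- (q Q.:* r) Q.:=
              p Q.:* (q Q.:* v Q.:+ s) Q.:+ Q.:- (q Q.:* (p Q.:* v Q.:+ r)))
               refl (N zero zero) (N (suc i) zero) (v zero) (S (suc i)) (S zero) ⟩
        N zero zero ⊛ (N (suc i) zero ⊛ v zero ⊕ S (suc i)) ⊕ ⊖ (N (suc i) zero ⊛ (N zero zero ⊛ v zero ⊕ S zero))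
          ≡⟨ cong₂ (λ x y → N zero zero ⊛ x ⊕ ⊖ (N (suc i) zero ⊛ y)) (rows (suc i)) (rows zero) ⟩
        N zero zero ⊛ 𝟘 ⊕ ⊖ (N (suc i) zero ⊛ 𝟘)
          ≡⟨ Q.solve 2 (λ p q → p Q.:* Q.con 0ℤ Q.:+ Q.:- (q Q.:* Q.con 0ℤ) Q.:= Q.con 0ℤ)
              refl (N zero zero) (N (suc i) zero) ⟩
        𝟘 ∎)
      where
      S : Fin (suc (suc n)) → Quartic
      S i = sum (λ j → N i (suc j) ⊛ v (suc j))

    -- The powers descend so that `𝟙` comes last: the vector entry that survives `eliminate` is then
    -- `𝟙`, and its coefficient is itself zero.
    powers : Fin 4 → Quartic
    powers 0F = t ⊛ (t ⊛ t)
    powers 1F = t ⊛ t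
    powers 2F = t
    powers 3F = 𝟙

    coordinate : Fin 4 → Quartic → ℤ
    coordinate 0F = x₃
    coordinate 1F = x₂
    coordinate 2F = x₁
    coordinate 3F = x₀

    -- This is a I - M, where M is the integer matrix of multiplication by `a` on the powers of τ,
    -- so it kills the vector of those powers. It is the determinant trick, with fraction-free
    -- elimination in place of the determinant.
    matrix : Fin 4 → Fin 4 → Quartic
    matrix i j = (if does (i ≟ j) then a else 𝟘) ⊕ ⌜ ℤ.- coordinate j (a ⊛ powers i) ⌝

    matrix-diagonal : ∀ i → Monic 1 (matrix i i)
    matrix-diagonal i rewrite dec-true (i ≟ i) refl = below-∷ z ([] , refl)
      (Q.solve 2 (λ a z → (a Q.:+ z) Q.:+ Q.:- (a Q.:* Q.con 1ℤ) Q.:= z Q.:+ a Q.:* Q.con 0ℤ) refl a ⌜ z ⌝)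
      where z = ℤ.- coordinate i (a ⊛ powers i)

    matrix-off-diagonal : ∀ i j → i ≢ j → Below 1 (matrix i j)
    matrix-off-diagonal i j i≢j rewrite dec-false (i ≟ j) i≢j = below-∷ z ([] , refl)
      (Q.solve 2 (λ a z → Q.con 0ℤ Q.:+ z Q.:= z Q.:+ a Q.:* Q.con 0ℤ) refl a ⌜ z ⌝)
      where z = ℤ.- coordinate j (a ⊛ powers i)

    matrix-powers : ∀ i → sum (λ j → matrix i j ⊛ powers j) ≡ 𝟘
    matrix-powers i = begin
      sum (λ j → matrix i j ⊛ powers j)
        ≡⟨ split i (λ j → ℤ.- coordinate j y) ⟩
      y ⊕ (⌜ ℤ.- x₃ y ⌝ ⊛ (t ⊛ (t ⊛ t)) ⊕ ⌜ ℤ.- x₂ y ⌝ ⊛ (t ⊛ t) ⊕ ⌜ ℤ.- x₁ y ⌝ ⊛ t ⊕ ⌜ ℤ.- x₀ y ⌝)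
        ≡⟨ cong₂ (λ z w → z ⊕ w) (basis y) (cong₂ _⊕_ (cong₂
            (λ z w → z ⊛ (t ⊛ (t ⊛ t)) ⊕ w ⊛ (t ⊛ t) ⊕ ⌜ ℤ.- x₁ y ⌝ ⊛ t) (⌜⌝-neg (x₃ y)) (⌜⌝-neg (x₂ y))) refl) ⟩
      (⌜ x₀ y ⌝ ⊕ ⌜ x₁ y ⌝ ⊛ t ⊕ ⌜ x₂ y ⌝ ⊛ (t ⊛ t) ⊕ ⌜ x₃ y ⌝ ⊛ (t ⊛ (t ⊛ t))) ⊕
      (⊖ ⌜ x₃ y ⌝ ⊛ (t ⊛ (t ⊛ t)) ⊕ ⊖ ⌜ x₂ y ⌝ ⊛ (t ⊛ t) ⊕ ⌜ ℤ.- x₁ y ⌝ ⊛ t ⊕ ⌜ ℤ.- x₀ y ⌝)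
        ≡⟨ cong₂ (λ z w → (⌜ x₀ y ⌝ ⊕ ⌜ x₁ y ⌝ ⊛ t ⊕ ⌜ x₂ y ⌝ ⊛ (t ⊛ t) ⊕ ⌜ x₃ y ⌝ ⊛ (t ⊛ (t ⊛ t))) ⊕
             (⊖ ⌜ x₃ y ⌝ ⊛ (t ⊛ (t ⊛ t)) ⊕ ⊖ ⌜ x₂ y ⌝ ⊛ (t ⊛ t) ⊕ z ⊛ t ⊕ w)) (⌜⌝-neg (x₁ y)) (⌜⌝-neg (x₀ y)) ⟩
      (⌜ x₀ y ⌝ ⊕ ⌜ x₁ y ⌝ ⊛ t ⊕ ⌜ x₂ y ⌝ ⊛ (t ⊛ t) ⊕ ⌜ x₃ y ⌝ ⊛ (t ⊛ (t ⊛ t))) ⊕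
      (⊖ ⌜ x₃ y ⌝ ⊛ (t ⊛ (t ⊛ t)) ⊕ ⊖ ⌜ x₂ y ⌝ ⊛ (t ⊛ t) ⊕ ⊖ ⌜ x₁ y ⌝ ⊛ t ⊕ ⊖ ⌜ x₀ y ⌝)
        ≡⟨ Q.solve 5 (λ b₀ b₁ b₂ b₃ t →
             (b₀ Q.:+ b₁ Q.:* t Q.:+ b₂ Q.:* (t Q.:* t) Q.:+ b₃ Q.:* (t Q.:* (t Q.:* t))) Q.:+
             (Q.:- b₃ Q.:* (t Q.:* (t Q.:* t)) Q.:+ Q.:- b₂ Q.:* (t Q.:* t) Q.:+ Q.:- b₁ Q.:* t Q.:+ Q.:- b₀) Q.:=
                 Q.con 0ℤ)
             refl ⌜ x₀ y ⌝ ⌜ x₁ y ⌝ ⌜ x₂ y ⌝ ⌜ x₃ y ⌝ t ⟩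
      𝟘 ∎
      where
      y = a ⊛ powers i
      split : ∀ i (m : Fin 4 → ℤ) →
        sum (λ j → ((if does (i ≟ j) then a else 𝟘) ⊕ ⌜ m j ⌝) ⊛ powers j) ≡
        a ⊛ powers i ⊕ (⌜ m 0F ⌝ ⊛ (t ⊛ (t ⊛ t)) ⊕ ⌜ m 1F ⌝ ⊛ (t ⊛ t) ⊕ ⌜ m 2F ⌝ ⊛ t ⊕ ⌜ m 3F ⌝)
      split 0F m = Q.solve 8 (λ a u v t m₀ m₁ m₂ m₃ →
        (a Q.:+ m₀) Q.:* u Q.:+ ((Q.con 0ℤ Q.:+ m₁) Q.:* v Q.:+
          ((Q.con 0ℤ Q.:+ m₂) Q.:* t Q.:+ ((Q.con 0ℤ Q.:+ m₃) Q.:* Q.con 1ℤ Q.:+ Q.con 0ℤ))) Q.:=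
        a Q.:* u Q.:+ (m₀ Q.:* u Q.:+ m₁ Q.:* v Q.:+ m₂ Q.:* t Q.:+ m₃))
        refl a (t ⊛ (t ⊛ t)) (t ⊛ t) t ⌜ m 0F ⌝ ⌜ m 1F ⌝ ⌜ m 2F ⌝ ⌜ m 3F ⌝
      split 1F m = Q.solve 8 (λ a u v t m₀ m₁ m₂ m₃ →
        (Q.con 0ℤ Q.:+ m₀) Q.:* u Q.:+ ((a Q.:+ m₁) Q.:* v Q.:+
          ((Q.con 0ℤ Q.:+ m₂) Q.:* t Q.:+ ((Q.con 0ℤ Q.:+ m₃) Q.:* Q.con 1ℤ Q.:+ Q.con 0ℤ))) Q.:=
        a Q.:* v Q.:+ (m₀ Q.:* u Q.:+ m₁ Q.:* v Q.:+ m₂ Q.:* t Q.:+ m₃))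
        refl a (t ⊛ (t ⊛ t)) (t ⊛ t) t ⌜ m 0F ⌝ ⌜ m 1F ⌝ ⌜ m 2F ⌝ ⌜ m 3F ⌝
      split 2F m = Q.solve 8 (λ a u v t m₀ m₁ m₂ m₃ →
        (Q.con 0ℤ Q.:+ m₀) Q.:* u Q.:+ ((Q.con 0ℤ Q.:+ m₁) Q.:* v Q.:+
          ((a Q.:+ m₂) Q.:* t Q.:+ ((Q.con 0ℤ Q.:+ m₃) Q.:* Q.con 1ℤ Q.:+ Q.con 0ℤ))) Q.:=
        a Q.:* t Q.:+ (m₀ Q.:* u Q.:+ m₁ Q.:* v Q.:+ m₂ Q.:* t Q.:+ m₃))
        refl a (t ⊛ (t ⊛ t)) (t ⊛ t) t ⌜ m 0F ⌝ ⌜ m 1F ⌝ ⌜ m 2F ⌝ ⌜ m 3F ⌝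
      split 3F m = Q.solve 8 (λ a u v t m₀ m₁ m₂ m₃ →
        (Q.con 0ℤ Q.:+ m₀) Q.:* u Q.:+ ((Q.con 0ℤ Q.:+ m₁) Q.:* v Q.:+
          ((Q.con 0ℤ Q.:+ m₂) Q.:* t Q.:+ ((a Q.:+ m₃) Q.:* Q.con 1ℤ Q.:+ Q.con 0ℤ))) Q.:=
        a Q.:* Q.con 1ℤ Q.:+ (m₀ Q.:* u Q.:+ m₁ Q.:* v Q.:+ m₂ Q.:* t Q.:+ m₃))
        refl a (t ⊛ (t ⊛ t)) (t ⊛ t) t ⌜ m 0F ⌝ ⌜ m 1F ⌝ ⌜ m 2F ⌝ ⌜ m 3F ⌝

    evalMonic-eval : ∀ {k} (v : Vec ℤ k) → evalMonicₒ (toList v) a ≡ eval a v ⊕ a ^ k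
    evalMonic-eval []      = sym (⊕-identityˡ 𝟙)
    evalMonic-eval {suc k} (z ∷ v) = trans (cong (λ w → ⌜ z ⌝ ⊕ a ⊛ w) (evalMonic-eval v))
      (Q.solve 4 (λ z a v b → z Q.:+ a Q.:* (v Q.:+ b) Q.:= (z Q.:+ a Q.:* v) Q.:+ a Q.:* b)
          refl ⌜ z ⌝ a (eval a v) (a ^ k))

    monic-relation : ∃ λ f → evalMonicₒ f a ≡ 𝟘
    monic-relation = 
      let k , x , (v , eq) , x≡𝟘 = eliminate 3 matrix powers matrix-diagonal matrix-off-diagonal matrix-powers
      in toList v , (begin
        evalMonicₒ (toList v) a          ≡⟨ evalMonic-eval v ⟩
        eval a v ⊕ a ^ k            ≡⟨ cong (_⊕ a ^ k) (sym eq) ⟩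
        (x ⊕ ⊖ a ^ k) ⊕ a ^ k       ≡⟨ Q.solve 2 (λ x b → (x Q.:+ Q.:- b) Q.:+ b Q.:= x Q.:* Q.con 1ℤ)
            refl x (a ^ k) ⟩
        x ⊛ 𝟙                       ≡⟨ x≡𝟘 ⟩
        𝟘                           ∎)

-- The embedding into ℚ(τ)

toℚᵘ-ι : ∀ z → ℚ.toℚᵘ (ι z) ≃ mkℚᵘ z 0
toℚᵘ-ι z = ℚₚ.toℚᵘ-fromℚᵘ (mkℚᵘ z 0)

ι-+ : ∀ x y → ι (x ℤ.+ y) ≡ ι x ℚ.+ ι y
ι-+ x y = ℚₚ.toℚᵘ-injective (begin
  ℚ.toℚᵘ (ι (x ℤ.+ y))                 ≈⟨ toℚᵘ-ι (x ℤ.+ y) ⟩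
  mkℚᵘ (x ℤ.+ y) 0                     ≈⟨ *≡* (solve 2 (λ x y → (x :+ y) :* con (+ 1) :=
      (x :* con (+ 1) :+ y :* con (+ 1)) :* con (+ 1)) refl x y) ⟩
  mkℚᵘ x 0 ℚᵘ.+ mkℚᵘ y 0               ≈⟨ ℚᵘₚ.+-cong (toℚᵘ-ι x) (toℚᵘ-ι y) ⟨
  ℚ.toℚᵘ (ι x) ℚᵘ.+ ℚ.toℚᵘ (ι y)       ≈⟨ ℚₚ.toℚᵘ-homo-+ (ι x) (ι y) ⟨
  ℚ.toℚᵘ (ι x ℚ.+ ι y)                 ∎)
  where open ℚᵘₚ.≃-Reasoning
        open +-*-Solver

ι-* : ∀ x y → ι (x ℤ.* y) ≡ ι x ℚ.* ι y
ι-* x y = ℚₚ.toℚᵘ-injective (begin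
  ℚ.toℚᵘ (ι (x ℤ.* y))                 ≈⟨ toℚᵘ-ι (x ℤ.* y) ⟩
  mkℚᵘ x 0 ℚᵘ.* mkℚᵘ y 0               ≈⟨ ℚᵘₚ.*-cong (toℚᵘ-ι x) (toℚᵘ-ι y) ⟨
  ℚ.toℚᵘ (ι x) ℚᵘ.* ℚ.toℚᵘ (ι y)       ≈⟨ ℚₚ.toℚᵘ-homo-* (ι x) (ι y) ⟨
  ℚ.toℚᵘ (ι x ℚ.* ι y)                 ∎)
  where open ℚᵘₚ.≃-Reasoning

ι-neg : ∀ x → ι (ℤ.- x) ≡ ℚ.- ι x
ι-neg x = ℚₚ.toℚᵘ-injective (begin
  ℚ.toℚᵘ (ι (ℤ.- x))      ≈⟨ toℚᵘ-ι (ℤ.- x) ⟩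
  ℚᵘ.- mkℚᵘ x 0           ≈⟨ ℚᵘₚ.-‿cong (toℚᵘ-ι x) ⟨
  ℚᵘ.- ℚ.toℚᵘ (ι x)       ≈⟨ ℚₚ.toℚᵘ-homo‿- (ι x) ⟨
  ℚ.toℚᵘ (ℚ.- ι x)        ∎)
  where open ℚᵘₚ.≃-Reasoning

ι-injective : ∀ {x y} → ι x ≡ ι y → x ≡ y
ι-injective {x} {y} eq with ℚᵘₚ.≃-trans (ℚᵘₚ.≃-sym (toℚᵘ-ι x)) (ℚᵘₚ.≃-trans (ℚᵘₚ.≃-reflexive
    (cong ℚ.toℚᵘ eq)) (toℚᵘ-ι y))
... | *≡* h = trans (sym (ℤₚ.*-identityʳ x)) (trans h (ℤₚ.*-identityʳ y))

ι-denominator : ∀ a → ι (ℚ.↧ a) ℚ.* a ≡ ι (ℚ.↥ a)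
ι-denominator a@record{} = ℚₚ.toℚᵘ-injective (begin
  ℚ.toℚᵘ (ι (ℚ.↧ a) ℚ.* a)              ≈⟨ ℚₚ.toℚᵘ-homo-* (ι (ℚ.↧ a)) a ⟩
  ℚ.toℚᵘ (ι (ℚ.↧ a)) ℚᵘ.* ℚ.toℚᵘ a      ≈⟨ ℚᵘₚ.*-congʳ (toℚᵘ-ι (ℚ.↧ a)) ⟩
  mkℚᵘ (ℚ.↧ a) 0 ℚᵘ.* ℚ.toℚᵘ a          ≈⟨ *≡* cross ⟩
  mkℚᵘ (ℚ.↥ a) 0                        ≈⟨ toℚᵘ-ι (ℚ.↥ a) ⟨
  ℚ.toℚᵘ (ι (ℚ.↥ a))                    ∎)
  where
  open ℚᵘₚ.≃-Reasoning
  cross : ℚ.↧ a ℤ.* ℚ.↥ a ℤ.* 1ℤ ≡ ℚ.↥ a ℤ.* + (1 ℕ.* ℚ.↧ₙ a)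
  cross = trans (ℤₚ.*-identityʳ _) (trans (ℤₚ.*-comm (ℚ.↧ a) (ℚ.↥ a))
    (cong (λ n → ℚ.↥ a ℤ.* + n) (sym (ℕₚ.*-identityˡ (ℚ.↧ₙ a)))))

⟨⟩-cong : ∀ {a a′ b b′ e e′ f f′} → a ≡ a′ → b ≡ b′ → e ≡ e′ → f ≡ f′ →
          ⟨ a , b , e , f ⟩ ≡ ⟨ a′ , b′ , e′ , f′ ⟩
⟨⟩-cong refl refl refl refl = refl

module Embedding (c d : ℤ) where

  open K
  open Order c d
  open Integrality c d
  open Roots c d
  open MonicRelation c d
  open ≡-Reasoning
  open ℕ-Solver using () renaming (_:*_ to infixl 8 _⊗_; _:=_ to infix 4 _⊜_)
  open ℚ-Solver using (solve; _:+_; _:*_; _:-_; :-_; con; _:=_)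

  _+ₖ_ _*ₖ_ : K → K → K
  _+ₖ_ = addK c d
  _*ₖ_ = mulK c d
  infixl 6 _+ₖ_
  infixl 7 _*ₖ_

  _·_ : ℚ → K → K
  _·_ = scaleK c d
  infixr 8 _·_

  emb : Quartic → K
  emb x = ⟨ ι (x₀ x) , ι (x₁ x) , ι (x₂ x) , ι (x₃ x) ⟩

  emb-injective : ∀ {x y} → emb x ≡ emb y → x ≡ y
  emb-injective eq = ⟪⟫-cong (ι-injective (cong a₀ eq)) (ι-injective (cong a₁ eq))
                             (ι-injective (cong a₂ eq)) (ι-injective (cong a₃ eq))

  ·-+ₖ : ∀ s x y → s · (x +ₖ y) ≡ s · x +ₖ s · y
  ·-+ₖ s x y = ⟨⟩-cong (ℚₚ.*-distribˡ-+ s _ _) (ℚₚ.*-distribˡ-+ s _ _) (ℚₚ.*-distribˡ-+ s _ _) (ℚₚ.*-distribˡ-+ s _ _)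

  ·-· : ∀ s r x → s · r · x ≡ (s ℚ.* r) · x
  ·-· s r x = sym (⟨⟩-cong (ℚₚ.*-assoc s r _) (ℚₚ.*-assoc s r _) (ℚₚ.*-assoc s r _) (ℚₚ.*-assoc s r _))

  ·-zero : ∀ s → s · zeroK c d ≡ zeroK c d
  ·-zero s = ⟨⟩-cong (ℚₚ.*-zeroʳ s) (ℚₚ.*-zeroʳ s) (ℚₚ.*-zeroʳ s) (ℚₚ.*-zeroʳ s)

  ·-mulτ : ∀ s x → s · mulτ c d x ≡ mulτ c d (s · x)
  ·-mulτ s x = ⟨⟩-cong
    (solve 3 (λ s d f → s :* :- (d :* f) := :- (d :* (s :* f))) refl s (ι d) (a₃ x))
    refl refl
    (solve 4 (λ s c e f → s :* (e :- c :* f) := s :* e :- c :* (s :* f)) refl s (ι c) (a₂ x) (a₃ x))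

  ·-*ₖ : ∀ s r x y → (s · x) *ₖ (r · y) ≡ (s ℚ.* r) · (x *ₖ y)
  ·-*ₖ s r x y = sym (begin
      sr · (x *ₖ y)
        ≡⟨ step y₀ (mulτ c d (y₁ · x +ₖ mulτ c d (y₂ · x +ₖ mulτ c d (y₃ · x)))) ⟩
      (r ℚ.* y₀) · s · x +ₖ sr · mulτ c d (y₁ · x +ₖ mulτ c d (y₂ · x +ₖ mulτ c d (y₃ · x)))
        ≡⟨ cong ((r ℚ.* y₀) · s · x +ₖ_) (shift y₁ (mulτ c d (y₂ · x +ₖ mulτ c d (y₃ · x)))) ⟩
      (r ℚ.* y₀) · s · x +ₖ mulτ c d ((r ℚ.* y₁) · s · x +ₖ sr · mulτ c d (y₂ · x +ₖ mulτ c d (y₃ · x)))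
        ≡⟨ cong (λ z → (r ℚ.* y₀) · s · x +ₖ mulτ c d ((r ℚ.* y₁) · s · x +ₖ z)) (shift y₂ (mulτ c d (y₃ · x))) ⟩
      (r ℚ.* y₀) · s · x +ₖ mulτ c d ((r ℚ.* y₁) · s · x +ₖ mulτ c d ((r ℚ.* y₂) · s · x +ₖ sr · mulτ c d (y₃ · x)))
        ≡⟨ cong (λ z → (r ℚ.* y₀) · s · x +ₖ mulτ c d ((r ℚ.* y₁) · s · x +ₖ mulτ c d ((r ℚ.* y₂) · s · x +ₖ z)))
             (trans (·-mulτ sr (y₃ · x)) (cong (mulτ c d) (swap y₃))) ⟩
      (s · x) *ₖ (r · y) ∎)
    where
    sr = s ℚ.* r
    y₀ = a₀ y
    y₁ = a₁ y
    y₂ = a₂ y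
    y₃ = a₃ y
    swap : ∀ z → sr · z · x ≡ (r ℚ.* z) · s · x
    swap z = trans (·-· sr z x) (trans (cong (_· x) (solve 3 (λ s r z → s :* r :* z := r :* z :* s)
        refl s r z)) (sym (·-· (r ℚ.* z) s x)))
    step : ∀ z w → sr · (z · x +ₖ w) ≡ (r ℚ.* z) · s · x +ₖ sr · w
    step z w = trans (·-+ₖ sr (z · x) w) (cong (_+ₖ sr · w) (swap z))
    shift : ∀ z w → sr · mulτ c d (z · x +ₖ w) ≡ mulτ c d ((r ℚ.* z) · s · x +ₖ sr · w)
    shift z w = trans (·-mulτ sr (z · x +ₖ w)) (cong (mulτ c d) (step z w))

  opaque
    unfolding _⊕_ mulT

    emb-⊕ : ∀ x y → emb (x ⊕ y) ≡ emb x +ₖ emb y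
    emb-⊕ x y = ⟨⟩-cong (ι-+ (x₀ x) (x₀ y)) (ι-+ (x₁ x) (x₁ y)) (ι-+ (x₂ x) (x₂ y)) (ι-+ (x₃ x) (x₃ y))

    emb-⊙ : ∀ s x → emb (s ⊙ x) ≡ ι s · emb x
    emb-⊙ s x = ⟨⟩-cong (ι-* s (x₀ x)) (ι-* s (x₁ x)) (ι-* s (x₂ x)) (ι-* s (x₃ x))

    emb-mulT : ∀ x → emb (mulT x) ≡ mulτ c d (emb x)
    emb-mulT x = ⟨⟩-cong (trans (ι-neg (d ℤ.* x₃ x)) (cong ℚ.-_ (ι-* d (x₃ x)))) refl refl
      (trans (ι-+ (x₂ x) (ℤ.- (c ℤ.* x₃ x))) (cong (λ z → ι (x₂ x) ℚ.+ z) (trans (ι-neg (c ℤ.* x₃ x))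
          (cong ℚ.-_ (ι-* c (x₃ x))))))

  -- `mulK` is defined by Horner's scheme and `_⊛_` by a sum over powers of `mulT`. In the nested
  -- form the two products correspond operation by operation under `emb`.
  ⊛-nested : ∀ x y → x ⊛ y ≡ x₀ y ⊙ x ⊕ mulT (x₁ y ⊙ x ⊕ mulT (x₂ y ⊙ x ⊕ mulT (x₃ y ⊙ x)))
  ⊛-nested x y = trans (⊛-lincomb-powers x y) (cong (x₀ y ⊙ x ⊕_)
      (pull (x₁ y) x (trans (pull (x₂ y) x′ (trans (pull₁ (x₃ y) (mulT x′)) (cong mulT (pull₁ (x₃ y) x′))))
          (cong mulT (pull (x₂ y) x (cong mulT (pull₁ (x₃ y) x)))))))
    where
    x′ = mulT x
    pull₁ : ∀ s u → s ⊙ mulT u ≡ mulT (s ⊙ u)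
    pull₁ s u = sym (mulT-⊙ s u)
    pull : ∀ s u {v w} → v ≡ mulT w → s ⊙ mulT u ⊕ v ≡ mulT (s ⊙ u ⊕ w)
    pull s u {w = w} refl = sym (trans (mulT-⊕ (s ⊙ u) w) (cong (_⊕ mulT w) (mulT-⊙ s u)))

  emb-⊛ : ∀ x y → emb (x ⊛ y) ≡ emb x *ₖ emb y
  emb-⊛ x y = begin
      emb (x ⊛ y)
        ≡⟨ cong emb (⊛-nested x y) ⟩
      emb (x₀ y ⊙ x ⊕ mulT (x₁ y ⊙ x ⊕ mulT (x₂ y ⊙ x ⊕ mulT (x₃ y ⊙ x))))
        ≡⟨ step (x₀ y) (shift (step (x₁ y) (shift (step (x₂ y) (shift (emb-⊙ (x₃ y) x)))))) ⟩
      emb x *ₖ emb y ∎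
    where
    step : ∀ s {z w} → emb z ≡ w → emb (s ⊙ x ⊕ z) ≡ ι s · emb x +ₖ w
    step s {z} refl = trans (emb-⊕ (s ⊙ x) z) (cong (_+ₖ emb z) (emb-⊙ s x))
    shift : ∀ {z w} → emb z ≡ w → emb (mulT z) ≡ mulτ c d w
    shift {z} refl = emb-mulT z

  emb-⌜⌝ : ∀ z → emb ⌜ z ⌝ ≡ ι z · oneK c d
  emb-⌜⌝ z = sym (⟨⟩-cong (ℚₚ.*-identityʳ (ι z)) (ℚₚ.*-zeroʳ (ι z)) (ℚₚ.*-zeroʳ (ι z)) (ℚₚ.*-zeroʳ (ι z)))

  evalₒ : List ℤ → Quartic → Quartic
  evalₒ []      a = 𝟘
  evalₒ (z ∷ h) a = ⌜ z ⌝ ⊕ a ⊛ evalₒ h a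

  -- `evalZ` and `evalMonic` differ only in the value at the empty list, so one step serves both.
  emb-horner : ∀ z a {x y} → emb x ≡ y → emb (⌜ z ⌝ ⊕ a ⊛ x) ≡ ι z · oneK c d +ₖ emb a *ₖ y
  emb-horner z a {x} refl = trans (emb-⊕ ⌜ z ⌝ (a ⊛ x)) (cong₂ _+ₖ_ (emb-⌜⌝ z) (emb-⊛ a x))

  emb-evalₒ : ∀ h a → emb (evalₒ h a) ≡ evalZ c d h (emb a)
  emb-evalₒ []      a = refl
  emb-evalₒ (z ∷ h) a = emb-horner z a (emb-evalₒ h a)

  emb-evalMonicₒonicₒ : ∀ f a → emb (evalMonicₒ f a) ≡ evalMonic c d f (emb a)
  emb-evalMonicₒonicₒ []      a = refl
  emb-evalMonicₒonicₒ (z ∷ f) a = emb-horner z a (emb-evalMonicₒonicₒ f a)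

  ⌜⌝-power : ∀ a n k → ⌜ a ⌝ ⊛ ⌜ n ⌝ ^ k ≡ ⌜ a ℤ.* n ℤ.^ k ⌝
  ⌜⌝-power a n k = sym (expand (Q.var 0F Q.:* (Q.var 1F Q.:^ k)) (a ∷ n ∷ []))

  -- If n α = β then nᵏ f(α) is the homogenisation of f at (β, n), where k = deg f.
  clear-denominators : ∀ n {α β} → ι n · α ≡ emb β → ∀ f →
    ι (n ℤ.^ length f) · evalMonic c d f α ≡ emb (hom (List.map ⌜_⌝ f) β ⌜ n ⌝)
  clear-denominators n nα≡β []      = refl
  clear-denominators n {α} {β} nα≡β (a ∷ f) = begin
    ι N · (ι a · oneK c d +ₖ α *ₖ E)
      ≡⟨ ·-+ₖ (ι N) (ι a · oneK c d) (α *ₖ E) ⟩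
    ι N · ι a · oneK c d +ₖ ι N · (α *ₖ E)
      ≡⟨ cong₂ _+ₖ_ (trans (·-· (ι N) (ι a) (oneK c d)) (cong (_· oneK c d) (trans (ℚₚ.*-comm (ι N) (ι a))
          (sym (ι-* a N)))))
                    (cong (_· (α *ₖ E)) (ι-* n (n ℤ.^ length f))) ⟩
    ι (a ℤ.* N) · oneK c d +ₖ (ι n ℚ.* ι (n ℤ.^ length f)) · (α *ₖ E)
      ≡⟨ cong₂ _+ₖ_ (sym (emb-⌜⌝ (a ℤ.* N))) (sym (·-*ₖ (ι n) (ι (n ℤ.^ length f)) α E)) ⟩
    emb ⌜ a ℤ.* N ⌝ +ₖ (ι n · α) *ₖ (ι (n ℤ.^ length f) · E)
      ≡⟨ cong₂ (λ x y → emb ⌜ a ℤ.* N ⌝ +ₖ x *ₖ y) nα≡β (clear-denominators n nα≡β f) ⟩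
    emb ⌜ a ℤ.* N ⌝ +ₖ emb β *ₖ emb H
      ≡⟨ cong₂ _+ₖ_ (cong emb (sym (⌜⌝-power a n (suc (length f))))) (sym (emb-⊛ β H)) ⟩
    emb (⌜ a ⌝ ⊛ ⌜ n ⌝ ^ suc (length f)) +ₖ emb (β ⊛ H)
      ≡⟨ sym (emb-⊕ (⌜ a ⌝ ⊛ ⌜ n ⌝ ^ suc (length f)) (β ⊛ H)) ⟩
    emb (⌜ a ⌝ ⊛ ⌜ n ⌝ ^ suc (length f) ⊕ β ⊛ H)
      ≡⟨ cong (λ k → emb (⌜ a ⌝ ⊛ ⌜ n ⌝ ^ suc k ⊕ β ⊛ H)) (sym (length-map ⌜_⌝ f)) ⟩
    emb (hom (List.map ⌜_⌝ (a ∷ f)) β ⌜ n ⌝) ∎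
    where
    N = n ℤ.^ suc (length f)
    E = evalMonic c d f α
    H = hom (List.map ⌜_⌝ f) β ⌜ n ⌝

  common-denominator : ∀ α → ∃ λ n → ℕ.NonZero n × ∃ λ β → ι (+ n) · α ≡ emb β
  common-denominator ⟨ a , b , e , f ⟩ = n , n≢0 ,
    ⟪ + (B ℕ.* E ℕ.* F) ℤ.* ℚ.↥ a , + (A ℕ.* E ℕ.* F) ℤ.* ℚ.↥ b , + (A ℕ.* B ℕ.* F) ℤ.* ℚ.↥ e ,
        + (A ℕ.* B ℕ.* E) ℤ.* ℚ.↥ f ⟫ ,
    ⟨⟩-cong
      (clear a (B ℕ.* E ℕ.* F) (move₀ A B E F)) (clear b (A ℕ.* E ℕ.* F) (move₁ A B E F))
      (clear e (A ℕ.* B ℕ.* F) (move₂ A B E F)) (clear f (A ℕ.* B ℕ.* E) refl)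
    where
    A = ℚ.↧ₙ a
    B = ℚ.↧ₙ b
    E = ℚ.↧ₙ e
    F = ℚ.↧ₙ f
    n = A ℕ.* B ℕ.* E ℕ.* F
    move₀ : ∀ A B E F → A ℕ.* B ℕ.* E ℕ.* F ≡ B ℕ.* E ℕ.* F ℕ.* A
    move₀ = ℕ-Solver.solve 4 (λ A B E F → A ⊗ B ⊗ E ⊗ F ⊜ B ⊗ E ⊗ F ⊗ A) refl
    move₁ : ∀ A B E F → A ℕ.* B ℕ.* E ℕ.* F ≡ A ℕ.* E ℕ.* F ℕ.* B
    move₁ = ℕ-Solver.solve 4 (λ A B E F → A ⊗ B ⊗ E ⊗ F ⊜ A ⊗ E ⊗ F ⊗ B) refl
    move₂ : ∀ A B E F → A ℕ.* B ℕ.* E ℕ.* F ≡ A ℕ.* B ℕ.* F ℕ.* E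
    move₂ = ℕ-Solver.solve 4 (λ A B E F → A ⊗ B ⊗ E ⊗ F ⊜ A ⊗ B ⊗ F ⊗ E) refl
    n≢0 : ℕ.NonZero n
    n≢0 = ℕₚ.m*n≢0 (A ℕ.* B ℕ.* E) F {{ℕₚ.m*n≢0 (A ℕ.* B) E {{ℕₚ.m*n≢0 A B}}}}
    clear : ∀ x k → n ≡ k ℕ.* ℚ.↧ₙ x → ι (+ n) ℚ.* x ≡ ι (+ k ℤ.* ℚ.↥ x)
    clear x k eq = begin
      ι (+ n) ℚ.* x                      ≡⟨ cong (λ m → ι m ℚ.* x) (trans (cong +_ eq) (ℤₚ.pos-* k (ℚ.↧ₙ x))) ⟩
      ι (+ k ℤ.* ℚ.↧ x) ℚ.* x            ≡⟨ cong (ℚ._* x) (ι-* (+ k) (ℚ.↧ x)) ⟩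
      ι (+ k) ℚ.* ι (ℚ.↧ x) ℚ.* x        ≡⟨ ℚₚ.*-assoc (ι (+ k)) (ι (ℚ.↧ x)) x ⟩
      ι (+ k) ℚ.* (ι (ℚ.↧ x) ℚ.* x)      ≡⟨ cong (ι (+ k) ℚ.*_) (ι-denominator x) ⟩
      ι (+ k) ℚ.* ι (ℚ.↥ x)              ≡⟨ sym (ι-* (+ k) (ℚ.↥ x)) ⟩
      ι (+ k ℤ.* ℚ.↥ x)                  ∎

  ·-cancel : ∀ n .{{_ : ℕ.NonZero n}} {x y} → ι (+ n) · x ≡ ι (+ n) · y → x ≡ y
  ·-cancel n eq = ⟨⟩-cong (cancel (cong a₀ eq)) (cancel (cong a₁ eq)) (cancel (cong a₂ eq)) (cancel (cong a₃ eq))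
    where
    q = ι (+ n)
    instance
      q≢0 : ℚ.NonZero q
      q≢0 = ℚₚ.pos⇒nonZero q {{ℚₚ.normalize-pos n 1}}
    inverse : ∀ u → (ℚ.1/ q) ℚ.* (q ℚ.* u) ≡ u
    inverse u = trans (sym (ℚₚ.*-assoc (ℚ.1/ q) q u)) (trans (cong (ℚ._* u) (ℚₚ.*-inverseˡ q)) (ℚₚ.*-identityˡ u))
    cancel : ∀ {u v} → q ℚ.* u ≡ q ℚ.* v → u ≡ v
    cancel {u} {v} qu≡qv = trans (sym (inverse u)) (trans (cong ((ℚ.1/ q) ℚ.*_) qu≡qv) (inverse v))

  coordinates-polynomial : ∀ x → evalₒ (x₀ x ∷ x₁ x ∷ x₂ x ∷ x₃ x ∷ []) t ≡ x
  coordinates-polynomial x = trans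
    (Q.solve 5 (λ a b e f t → a Q.:+ t Q.:* (b Q.:+ t Q.:* (e Q.:+ t Q.:* (f Q.:+ t Q.:* Q.con 0ℤ))) Q.:=
      a Q.:+ b Q.:* t Q.:+ e Q.:* (t Q.:* t) Q.:+ f Q.:* (t Q.:* (t Q.:* t)))
          refl ⌜ x₀ x ⌝ ⌜ x₁ x ⌝ ⌜ x₂ x ⌝ ⌜ x₃ x ⌝ t)
    (sym (basis x))

  emb-t : emb t ≡ τ c d
  emb-t = refl

  emb-evalₒ-t : ∀ h → emb (evalₒ h t) ≡ evalZ c d h (τ c d)
  emb-evalₒ-t h = trans (emb-evalₒ h t) (cong (evalZ c d h) emb-t)

  emb-integral : ∀ a → IsIntegral c d (emb a)
  emb-integral a = transfer (Span.monic-relation a)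
    where
    transfer : (∃ λ f → evalMonicₒ f a ≡ 𝟘) → IsIntegral c d (emb a)
    transfer (f , f≡𝟘) = f , trans (sym (emb-evalMonicₒonicₒ f a)) (cong emb f≡𝟘)

  polynomial⇒integral : ∀ α → _∈ℤ[_] c d α (τ c d) → IsIntegral c d α
  polynomial⇒integral α (h , α≡) = subst (IsIntegral c d) (sym (trans α≡
      (sym (emb-evalₒ-t h)))) (emb-integral (evalₒ h t))

  emb∈ℤ[τ] : ∀ x → _∈ℤ[_] c d (emb x) (τ c d)
  emb∈ℤ[τ] x = h , trans (cong emb (sym (coordinates-polynomial x))) (emb-evalₒ-t h)
    where
    h = x₀ x ∷ x₁ x ∷ x₂ x ∷ x₃ x ∷ []

  -- The equation of α multiplied by a power of n lies in the image of ℤ[τ], where `emb` is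
  -- injective.
  numerator-integral : ∀ n {α β} → ι n · α ≡ emb β → IsIntegral c d α → Integral β ⌜ n ⌝
  numerator-integral n {α} {β} nα≡β (f , f≡0) = List.map ⌜_⌝ f , emb-injective (begin
    emb (hom (List.map ⌜_⌝ f) β ⌜ n ⌝)                  ≡⟨ sym (clear-denominators n nα≡β f) ⟩
    ι (n ℤ.^ length f) · evalMonic c d f α              ≡⟨ cong (ι (n ℤ.^ length f) ·_) f≡0 ⟩
    ι (n ℤ.^ length f) · zeroK c d                      ≡⟨ ·-zero (ι (n ℤ.^ length f)) ⟩
    emb 𝟘                                               ∎)

  quotient : ∀ n .{{_ : ℕ.NonZero n}} {α β γ} → ι (+ n) · α ≡ emb β → β ≡ ⌜ + n ⌝ ⊛ γ → α ≡ emb γ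
  quotient n {α} {β} {γ} nα≡β β≡nγ = ·-cancel n (begin
    ι (+ n) · α            ≡⟨ nα≡β ⟩
    emb β                  ≡⟨ cong emb (trans β≡nγ (⌜⌝-⊛ (+ n) γ)) ⟩
    emb ((+ n) ⊙ γ)        ≡⟨ emb-⊙ (+ n) γ ⟩
    ι (+ n) · emb γ        ∎)

theorem3p2 : (c d : ℤ) → SquareFree d → NoOddPrimeSquareDivides (Δcd c d)
    → ((+ 4) ∣ Δcd c d → ((c %ℕ 4 ≡ 0) × (d %ℕ 4 ≡ 1)) ⊎ ((c %ℕ 4 ≡ 2) × (d %ℕ 4 ≡ 3)))
    → IrreducibleQ (gcd-poly c d)
    → Monogenic c d × RingOfIntegersIs c d (τ c d)
theorem3p2 c d squareFree noOddSquare at-2 _ = (τ c d , ringOfIntegers) , ringOfIntegers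
  where
  open Order c d
  open Embedding c d
  open Maximality c d squareFree noOddSquare at-2

  -- Write α = β / n with β in ℤ[τ]. Integrality of α becomes that of β / n in the homogenised
  -- sense, which forces n to divide β.
  integral⇒polynomial : ∀ α → IsIntegral c d α → _∈ℤ[_] c d α (τ c d)
  integral⇒polynomial α int = cleared (common-denominator α)
    where
    divided : ∀ n .{{_ : ℕ.NonZero n}} {β} → ι (+ n) · α ≡ emb β → (∃ λ γ → β ≡ ⌜ + n ⌝ ⊛ γ) → _∈ℤ[_] c d α (τ c d)
    divided n nα≡β (γ , β≡nγ) = subst (λ z → _∈ℤ[_] c d z (τ c d)) (sym (quotient n nα≡β β≡nγ)) (emb∈ℤ[τ] γ)
    cleared : (∃ λ n → ℕ.NonZero n × ∃ λ β → ι (+ n) · α ≡ emb β) → _∈ℤ[_] c d α (τ c d)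
    cleared (n , n≢0 , β , nα≡β) =
      divided n {{n≢0}} {β} nα≡β (integral-divides n {{n≢0}} (numerator-integral (+ n) nα≡β int))

  ringOfIntegers : RingOfIntegersIs c d (τ c d)
  ringOfIntegers α = mk⇔ (integral⇒polynomial α) (polynomial⇒integral α)
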